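{- There is an $n^{d+O(1)}$-delay enumeration algorithm that, given a connected $d$-claw free graph $G$ with $n$ vertices, outputs all minimal connected vertex covers of $G$ (Minimal Connected Vertex Cover Enumeration).
   Context: Graphs are finite, undirected and simple. For $d\in\mathbb N$, a $d$-claw is a star graph with $d$ leaves; a graph is $d$-claw free if it has no $d$-claw as an induced subgraph. A vertex cover of $G$ is a set $C\subseteq V(G)$ such that every edge has at least one end vertex in $C$; it is connected if the induced subgraph $G[C]$ is connected. A connected vertex cover is minimal if no proper subset of it is a connected vertex cover. Minimal Connected Vertex Cover Enumeration is the problem of outputting, each exactly once, all minimal connected vertex covers of the input graph. An enumeration algorithm has delay $D$ (is a $D$-delay algorithm) if the time elapsed between every two consecutive outputs, including pre-processing and post-processing, is at most $D$. The constant hidden in $O(1)$ is absolute. -}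

module Defs where

open import Data.Bool using (Bool; true; false; T)
open import Data.Fin using (Fin; zero; suc)
open import Data.Fin.Subset using (Subset; _∈_; _⊂_)
open import Data.List using (List; []; _∷_; _++_; map; foldr; replicate; allFin)
open import Data.List.Membership.Propositional using () renaming (_∈_ to _∈ₗ_)
open import Data.List.Relation.Unary.All using (All)
open import Data.List.Relation.Unary.Unique.Propositional using (Unique)
open import Data.Nat using (ℕ; suc; _+_; _≤_)
open import Data.Product using (Σ; ∃; _×_; proj₁)
open import Data.Sum using (_⊎_)
open import Data.Vec as Vec using (Vec; lookup; _[_]≔_; toList)
open import Function.Bundles using (_⇔_)
open import Function.Definitions using (Injective)
open import Relation.Binary.Construct.Closure.ReflexiveTransitive using (Star)
open import Relation.Binary.PropositionalEquality using (_≡_; refl)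
open import Relation.Nullary using (¬_)

------------------------------------------------------------------------
-- Graphs

record Graph (V : Set) : Set where
  field
    adj    : V → V → Bool
    sym    : ∀ u v → adj u v ≡ adj v u
    irrefl : ∀ v → adj v v ≡ false

  Adj : V → V → Set
  Adj u v = T (adj u v)

open Graph public using (adj; Adj)

-- The graph without vertices counts as connected.
Connected : ∀ {V} → Graph V → Set
Connected G = ∀ u v → Star (Adj G) u v

_[_] : ∀ {n} → Graph (Fin n) → (C : Subset n) → Graph (∃ λ v → v ∈ C)
G [ C ] = record
  { adj    = λ u v → adj G (proj₁ u) (proj₁ v)
  ; sym    = λ u v → Graph.sym G (proj₁ u) (proj₁ v)
  ; irrefl = λ v → Graph.irrefl G (proj₁ v)
  }

-- G has an induced subgraph isomorphic to H.
_InducedIn_ : ∀ {U V} → Graph U → Graph V → Set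
_InducedIn_ {U} {V} H G =
  Σ (U → V) λ f → Injective _≡_ _≡_ f × (∀ x y → adj G (f x) (f y) ≡ adj H x y)

-- The star with centre zero and d leaves.
claw : (d : ℕ) → Graph (Fin (suc d))
claw d = record { adj = a ; sym = s ; irrefl = i }
  where
  a : Fin (suc d) → Fin (suc d) → Bool
  a zero    zero    = false
  a zero    (suc _) = true
  a (suc _) zero    = true
  a (suc _) (suc _) = false

  s : ∀ u v → a u v ≡ a v u
  s zero    zero    = refl
  s zero    (suc _) = refl
  s (suc _) zero    = refl
  s (suc _) (suc _) = refl

  i : ∀ v → a v v ≡ false
  i zero    = refl
  i (suc _) = refl

ClawFree : ∀ {V} → ℕ → Graph V → Set
ClawFree d G = ¬ (claw d InducedIn G)

VertexCover : ∀ {n} → Graph (Fin n) → Subset n → Set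
VertexCover G C = ∀ u v → Adj G u v → u ∈ C ⊎ v ∈ C

ConnectedVertexCover : ∀ {n} → Graph (Fin n) → Subset n → Set
ConnectedVertexCover G C = VertexCover G C × Connected (G [ C ])

MinimalConnectedVertexCover : ∀ {n} → Graph (Fin n) → Subset n → Set
MinimalConnectedVertexCover G C =
  ConnectedVertexCover G C × (∀ C′ → C′ ⊂ C → ¬ ConnectedVertexCover G C′)

------------------------------------------------------------------------
-- Model of computation: Jones' WHILE language (Computability and Complexity
-- from a Programming Perspective, 1997) with an additional output command.
-- Data are binary trees, a program has a fixed finite number of variables, and
-- every elementary operation takes unit time.  Representing trees by shared
-- pointers makes each operation constant time on a RAM; conversely WHILE
-- simulates Turing machines with polynomial overhead.

infixr 5 _∙_

data Tree : Set where
  nil : Tree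
  _∙_ : Tree → Tree → Tree

head tail : Tree → Tree
head nil     = nil
head (s ∙ _) = s
tail nil     = nil
tail (_ ∙ t) = t

data Expr (k : ℕ) : Set where
  var   : Fin k → Expr k
  nil   : Expr k
  cons  : Expr k → Expr k → Expr k
  hd tl : Expr k → Expr k

infix 5 _:=_
infixr 4 _⨟_
infix 5 if_then_else_ while_loop_

data Command (k : ℕ) : Set where
  _:=_          : Fin k → Expr k → Command k
  _⨟_           : Command k → Command k → Command k
  if_then_else_ : Expr k → Command k → Command k → Command k
  while_loop_   : Expr k → Command k → Command k
  output        : Expr k → Command k

Store : ℕ → Set
Store k = Vec Tree k

eval : ∀ {k} → Expr k → Store k → Tree
eval (var x)    σ = lookup σ x
eval nil        σ = nil
eval (cons e f) σ = eval e σ ∙ eval f σ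
eval (hd e)     σ = head (eval e σ)
eval (tl e)     σ = tail (eval e σ)

cost : ∀ {k} → Expr k → ℕ
cost (var _)    = 1
cost nil        = 1
cost (cons e f) = 1 + cost e + cost f
cost (hd e)     = 1 + cost e
cost (tl e)     = 1 + cost e

-- One event per unit of time.
data Event : Set where
  tick : Event
  out  : Tree → Event

Trace : Set
Trace = List Event

ticks : ℕ → Trace
ticks m = replicate m tick

-- Exec c σ τ σ′: started in σ, the command c halts in σ′ with trace τ.
-- Tests regard nil as false and every other tree as true.
data Exec {k : ℕ} : Command k → Store k → Trace → Store k → Set where
  assign  : ∀ {x e σ} →
            Exec (x := e) σ (ticks (1 + cost e)) (σ [ x ]≔ eval e σ)
  seq     : ∀ {c₁ c₂ σ₁ σ₂ σ₃ τ₁ τ₂} →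
            Exec c₁ σ₁ τ₁ σ₂ → Exec c₂ σ₂ τ₂ σ₃ →
            Exec (c₁ ⨟ c₂) σ₁ (τ₁ ++ τ₂) σ₃
  ifTrue  : ∀ {e c₁ c₂ σ σ′ τ s t} → eval e σ ≡ s ∙ t → Exec c₁ σ τ σ′ →
            Exec (if e then c₁ else c₂) σ (ticks (1 + cost e) ++ τ) σ′
  ifFalse : ∀ {e c₁ c₂ σ σ′ τ} → eval e σ ≡ nil → Exec c₂ σ τ σ′ →
            Exec (if e then c₁ else c₂) σ (ticks (1 + cost e) ++ τ) σ′
  stop    : ∀ {e c σ} → eval e σ ≡ nil →
            Exec (while e loop c) σ (ticks (1 + cost e)) σ
  loop    : ∀ {e c σ₁ σ₂ σ₃ τ₁ τ₂ s t} → eval e σ₁ ≡ s ∙ t →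
            Exec c σ₁ τ₁ σ₂ → Exec (while e loop c) σ₂ τ₂ σ₃ →
            Exec (while e loop c) σ₁ (ticks (1 + cost e) ++ τ₁ ++ τ₂) σ₃
  emit    : ∀ {e σ} →
            Exec (output e) σ (ticks (cost e) ++ out (eval e σ) ∷ []) σ

-- The input is in variable zero; all other variables start as nil.
record Program : Set where
  constructor program
  field
    {extraVars} : ℕ
    body        : Command (suc extraVars)

Runs : Program → Tree → Trace → Set
Runs (program body) input τ =
  ∃ λ σ → Exec body (input Vec.∷ Vec.replicate _ nil) τ σ

outputs : Trace → List Tree
outputs []          = []
outputs (tick  ∷ τ) = outputs τ
outputs (out t ∷ τ) = t ∷ outputs τ

-- The times from the start to the first output, between consecutive outputs,
-- and from the last output to halting; k is the time already elapsed since the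
-- last output (or the start).
gapsFrom : ℕ → Trace → List ℕ
gapsFrom k []          = k ∷ []
gapsFrom k (tick  ∷ τ) = gapsFrom (suc k) τ
gapsFrom k (out _ ∷ τ) = suc k ∷ gapsFrom 0 τ

HasDelay : ℕ → Trace → Set
HasDelay D τ = All (_≤ D) (gapsFrom 0 τ)

------------------------------------------------------------------------
-- Encodings: a graph is given by the rows of its adjacency matrix, a vertex
-- set by its characteristic vector.

encodeBool : Bool → Tree
encodeBool false = nil
encodeBool true  = nil ∙ nil

encodeList : ∀ {A : Set} → (A → Tree) → List A → Tree
encodeList enc = foldr (λ x t → enc x ∙ t) nil

encodeGraph : ∀ {n} → Graph (Fin n) → Tree
encodeGraph {n} G = encodeList row vertices
  where
  vertices : List (Fin n)
  vertices = allFin n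

  row : Fin n → Tree
  row u = encodeList (λ v → encodeBool (adj G u v)) vertices

encodeSubset : ∀ {n} → Subset n → Tree
encodeSubset C = encodeList encodeBool (toList C)

-- P halts on G and outputs exactly the sets satisfying Φ, each exactly once,
-- with delay at most D.
Enumerates : ∀ {n} → Program → Graph (Fin n) → (Subset n → Set) → ℕ → Set
Enumerates {n} P G Φ D =
  ∃ λ τ → Runs P (encodeGraph G) τ × HasDelay D τ ×
  ∃ λ (Cs : List (Subset n)) →
    outputs τ ≡ map encodeSubset Cs × Unique Cs × (∀ C → C ∈ₗ Cs ⇔ Φ C)

{-# OPTIONS --safe #-}

-- In a connected graph every superset of a connected vertex cover is one, so
-- deleting redundant vertices greedily turns any connected vertex cover into a
-- minimal one.  From a minimal cover X and v ∈ X one moves to other minimal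
-- covers by starting with (X ─ v) ∪ N v, adding vertices until the set is
-- connected, and minimising.  A maximal independent subset of N v meets every
-- component of this set, so by claw-freeness there are at most d components.
-- Each added vertex joins the component K of a fixed vertex to another one, hence
-- at most d rounds of branching over n vertices are needed.  If Z is another
-- minimal cover and v ∉ Z, some branch stays inside (X ∪ Z) ─ v, hence one of the
-- moves yields a cover with fewer vertices outside Z; thus all minimal covers are
-- reachable from any one of them.  A depth-first search that stores the covers
-- found in a trie performs boundedly many moves between two outputs.

module Submission where

open import Defs
open import Data.Bool using (Bool; true; false; T; _∧_; _∨_; not) renaming (if_then_else_ to ifᵇ_then_else_)
open import Data.Bool.Properties as Bool using (T-≡; T?)
open import Data.Empty using (⊥-elim)
open import Data.Fin as Fin using (Fin; zero; suc; toℕ; inject≤; _↑ʳ_)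
open import Data.Fin.Patterns using (0F; 1F; 2F; 3F; 4F; 5F)
open import Data.Fin.Properties using (_≟_; inject≤-injective; combine-injective; injective⇒≤)
open import Data.Fin.Subset
  using (Subset; ⊥; ⊤; ⁅_⁆; _∩_; _∪_; _─_; _∈_; _∉_; _⊆_; ∣_∣; Nonempty; Empty)
open import Data.Fin.Subset.Properties
open import Data.List as List using (List; []; _∷_; _++_; map; filter; foldl; allFin; length; _ʳ++_)
open import Data.List.Membership.Propositional using (find; lose) renaming (_∈_ to _∈ₗ_; _∉_ to _∉ₗ_)
open import Data.List.Membership.Propositional.Properties
  using (∈-allFin; ∈-filter⁺; ∈-lookup; ∈-++⁺ˡ; ∈-++⁺ʳ; ∈-++⁻)
open import Data.List.Properties
  using (length-++; length-tabulate; length-take; length-reverse; filter-notAll;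
         ++-assoc; ++-identityʳ; reverse-involutive)
open import Data.List.Relation.Unary.All as All using (All; []; _∷_)
import Data.List.Relation.Unary.All.Properties as All
open import Data.List.Relation.Unary.AllPairs using (AllPairs; []; _∷_)
open import Data.List.Relation.Unary.Any as Any using (here; there)
open import Data.List.Relation.Unary.Unique.Propositional using (Unique)
import Data.List.Relation.Unary.Unique.Propositional.Properties as Unique
open import Data.Nat as ℕ
  using (ℕ; zero; suc; _+_; _*_; _^_; _⊔_; _≤_; _<_; z≤n; s≤s; NonZero; >-nonZero)
open import Data.Nat.Properties as ℕ
  using (≤-trans; ≤-refl; ≤-reflexive; ≰⇒>; <⇒≤; <-≤-trans; m≤m+n; m≤n+m; m≤m⊔n; m≤n⊔m;
         +-assoc; +-comm; +-identityʳ; +-suc; suc-injective; +-mono-≤; +-monoʳ-≤; *-identityʳ; *-mono-≤;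
         *-monoˡ-≤; ^-monoʳ-≤; ^-distribˡ-+-*; m^n>0; module ≤-Reasoning)
open import Data.Nat.Tactic.RingSolver using (solve-∀)
open import Data.Product using (∃; ∃₂; ∃-syntax; _×_; _,_; proj₁; proj₂)
open import Data.Sum as Sum using (_⊎_; inj₁; inj₂; [_,_]′)
open import Data.Vec as Vec using (Vec; []; _∷_; lookup; zipWith; toList; tabulate; here; there)
open import Data.Vec.Properties
  using (length-toList; lookup∘tabulate; lookup⇒[]=; []=⇒lookup; ≡-dec)
open import Data.Vec.Properties.WithK using ([]=-irrelevant)
open import Function using (_∘_; id; _⇔_; mk⇔)
open import Function.Bundles using (Equivalence)
open import Relation.Binary.Construct.Closure.ReflexiveTransitive as Star using (Star; ε; _◅_; _◅◅_)
open import Relation.Binary.PropositionalEquality hiding ([_])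
open import Relation.Nullary
  using (¬_; Dec; yes; no; contradiction; Reflects; ofʸ; ofⁿ; ¬?; _⊎-dec_)
open import Relation.Nullary.Reflects using (fromEquivalence)

-- Terms over trees and their compilation to WHILE

-- One program has to serve every `d`, so `d` never enters the program. It only bounds the potential
-- `spread n d` of the sets waiting to be repaired, and because this potential occurs in a single
-- product of the time bound, `d` enters the exponent with coefficient one. Everything else must
-- cost a power whose exponent is fixed by the program text. To get this without analysing each
-- subroutine, the subroutines are terms whose only loop is a fold over the `n` adjacency rows;
-- `bound` and `degree` then read the exponent off the syntax. Powers are taken of `n ⊔ 2`, since
-- constants are absorbed only by powers of a base at least 2. There may be exponentially many
-- covers, hence a trie of depth `n`, in which a lookup costs `n` steps. A cover is output just
-- before it is expanded, so two consecutive outputs enclose exactly one expansion and the repair of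
-- the sets it creates.

Run : ∀ {k} → Command k → Store k → ℕ → Store k → Set
Run c σ m σ′ = ∃ λ j → j ≤ m × Exec c σ (ticks j) σ′

ticks-+ : ∀ a b → ticks a ++ ticks b ≡ ticks (a + b)
ticks-+ zero    b = refl
ticks-+ (suc a) b = cong (tick ∷_) (ticks-+ a b)

exec-≡ : ∀ {k} {c : Command k} {σ τ τ′ σ′} → τ ≡ τ′ → Exec c σ τ σ′ → Exec c σ τ′ σ′
exec-≡ refl e = e

run-weaken : ∀ {k} {c : Command k} {σ σ′ m m′} → m ≤ m′ → Run c σ m σ′ → Run c σ m′ σ′
run-weaken le (j , j≤ , e) = j , ≤-trans j≤ le , e

run-assign : ∀ {k} {x : Fin k} {e σ} → Run (x := e) σ (1 + cost e) (σ Vec.[ x ]≔ eval e σ)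
run-assign = _ , ≤-refl , assign

infixr 4 _⨾_
_⨾_ : ∀ {k} {c d : Command k} {σ₁ σ₂ σ₃ a b} →
      Run c σ₁ a σ₂ → Run d σ₂ b σ₃ → Run (c ⨟ d) σ₁ (a + b) σ₃
(i , i≤ , e) ⨾ (j , j≤ , f) = i + j , +-mono-≤ i≤ j≤ , exec-≡ (ticks-+ i j) (seq e f)

-- Both branches are charged, as in `bound`, so that the estimate does not depend on the outcome of
-- the test.
run-ifTrue : ∀ {k} {e} {c d : Command k} {σ σ′ s t a b} → eval e σ ≡ s ∙ t →
             Run c σ a σ′ → Run (if e then c else d) σ (1 + cost e + (a + b)) σ′
run-ifTrue {e = e} {a = a} {b} eq (j , j≤ , ex) =
  1 + cost e + j , +-monoʳ-≤ (1 + cost e) (≤-trans j≤ (m≤m+n a b)) ,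
  exec-≡ (ticks-+ (1 + cost e) j) (ifTrue eq ex)

run-ifFalse : ∀ {k} {e} {c d : Command k} {σ σ′ a b} → eval e σ ≡ nil →
              Run d σ b σ′ → Run (if e then c else d) σ (1 + cost e + (a + b)) σ′
run-ifFalse {e = e} {a = a} {b} eq (j , j≤ , ex) =
  1 + cost e + j , +-monoʳ-≤ (1 + cost e) (≤-trans j≤ (m≤n+m b a)) ,
  exec-≡ (ticks-+ (1 + cost e) j) (ifFalse eq ex)

run-stop : ∀ {k} {e} {c : Command k} {σ} → eval e σ ≡ nil → Run (while e loop c) σ (1 + cost e) σ
run-stop eq = _ , ≤-refl , stop eq

run-loop : ∀ {k} {e} {c : Command k} {σ₁ σ₂ σ₃ s t a b} → eval e σ₁ ≡ s ∙ t →
           Run c σ₁ a σ₂ → Run (while e loop c) σ₂ b σ₃ →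
           Run (while e loop c) σ₁ (1 + cost e + (a + b)) σ₃
run-loop {e = e} eq (i , i≤ , f) (j , j≤ , g) =
  1 + cost e + (i + j) , +-monoʳ-≤ (1 + cost e) (+-mono-≤ i≤ j≤) ,
  exec-≡ (trans (cong (ticks (1 + cost e) ++_) (ticks-+ i j)) (ticks-+ (1 + cost e) (i + j)))
         (loop eq f g)

-- Bounds the running time of a command all of whose loops are iterated at most n times.
bound : ∀ {k} → ℕ → Command k → ℕ
bound n (x := e)              = 1 + cost e
bound n (c ⨟ d)               = bound n c + bound n d
bound n (if e then c else d)  = 1 + cost e + (bound n c + bound n d)
bound n (while e loop c)      = n * (1 + cost e + bound n c) + (1 + cost e)
bound n (output e)            = cost e

-- A term language whose loops run over the adjacency rows

-- `fold` takes an initial value and a body but no list: it always runs over the rows of the graph,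
-- so every loop makes exactly `n` iterations. Other lists are traversed by carrying them in the
-- accumulator and consuming one entry per row.
data Term (k : ℕ) : Set where
  var  : Fin k → Term k
  nil  : Term k
  cons : Term k → Term k → Term k
  hd   : Term k → Term k
  tl   : Term k → Term k
  ite  : Term k → Term k → Term k → Term k
  let′ : Term k → Term (suc k) → Term k
  fold : Term k → Term (2 + k) → Term k

module _ {n} (V : Vec Tree n) where

  mutual
    infix 3 _⊢_⇓_
    data _⊢_⇓_ {k} (ρ : Vec Tree k) : Term k → Tree → Set where
      var  : ∀ {x} → ρ ⊢ var x ⇓ lookup ρ x
      nil  : ρ ⊢ nil ⇓ nil
      cons : ∀ {a b s t} → ρ ⊢ a ⇓ s → ρ ⊢ b ⇓ t → ρ ⊢ cons a b ⇓ s ∙ t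
      hd   : ∀ {a t} → ρ ⊢ a ⇓ t → ρ ⊢ hd a ⇓ head t
      tl   : ∀ {a t} → ρ ⊢ a ⇓ t → ρ ⊢ tl a ⇓ tail t
      ifT  : ∀ {a b c s t v} → ρ ⊢ a ⇓ s ∙ t → ρ ⊢ b ⇓ v → ρ ⊢ ite a b c ⇓ v
      ifF  : ∀ {a b c v} → ρ ⊢ a ⇓ nil → ρ ⊢ c ⇓ v → ρ ⊢ ite a b c ⇓ v
      let′ : ∀ {a b u v} → ρ ⊢ a ⇓ u → u ∷ ρ ⊢ b ⇓ v → ρ ⊢ let′ a b ⇓ v
      fold : ∀ {a b u v} → ρ ⊢ a ⇓ u → Loop ρ b V u v → ρ ⊢ fold a b ⇓ v

    data Loop {k} (ρ : Vec Tree k) (b : Term (2 + k)) : ∀ {m} → Vec Tree m → Tree → Tree → Set where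
      done : ∀ {u} → Loop ρ b [] u u
      next : ∀ {m x} {xs : Vec Tree m} {u v w} →
             u ∷ x ∷ ρ ⊢ b ⇓ v → Loop ρ b xs v w → Loop ρ b (x ∷ xs) u w

⟨_⟩ : ∀ {k} → Vec Tree k → Tree
⟨ [] ⟩    = nil
⟨ t ∷ ρ ⟩ = t ∙ ⟨ ρ ⟩

env stk rows : Expr 3
env  = var 0F
stk  = var 1F
rows = var 2F

path : ∀ {k} → Fin k → Expr 3 → Expr 3
path zero    e = hd e
path (suc i) e = path i (tl e)

eval-path : ∀ {k} (ρ : Vec Tree k) i {e} {σ : Store 3} → eval e σ ≡ ⟨ ρ ⟩ → eval (path i e) σ ≡ lookup ρ i
eval-path (t ∷ ρ) zero    eq = cong head eq
eval-path (t ∷ ρ) (suc i) eq = eval-path ρ i (cong tail eq)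

-- Evaluates a term in the environment held in variable 0 and pushes its value
-- on the stack held in variable 1; a fold runs over the list in variable 2.
mutual
  compile : ∀ {k} → Term k → Command 3
  compile (var x)     = 1F := cons (path x env) stk
  compile nil         = 1F := cons nil stk
  compile (cons a b)  = compile a ⨟ compile b ⨟
                        1F := cons (cons (hd (tl stk)) (hd stk)) (tl (tl stk))
  compile (hd a)      = compile a ⨟ 1F := cons (hd (hd stk)) (tl stk)
  compile (tl a)      = compile a ⨟ 1F := cons (tl (hd stk)) (tl stk)
  compile (ite a b c) = compile a ⨟ if hd stk then (1F := tl stk ⨟ compile b)
                                              else (1F := tl stk ⨟ compile c)
  compile (let′ a b)  = compile a ⨟ 0F := cons (hd stk) env ⨟ 1F := tl stk ⨟
                        compile b ⨟ 0F := tl env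
  compile (fold a b)  = compile a ⨟ 1F := cons rows stk ⨟
                        (while hd stk loop foldBody b) ⨟ 1F := tl stk

  -- Between iterations the stack holds the remaining rows above the accumulator. The body moves the
  -- accumulator and the current row into the environment and afterwards restores this layout.
  foldBody : ∀ {k} → Term (2 + k) → Command 3
  foldBody b = 0F := cons (hd (tl stk)) (cons (hd (hd stk)) env) ⨟
               1F := cons (tl (hd stk)) (tl (tl stk)) ⨟
               compile b ⨟
               0F := tl (tl env) ⨟
               1F := cons (hd (tl stk)) (cons (hd stk) (tl (tl stk)))

module _ {n} (V : Vec Tree n) where

  store : ∀ {k} → Vec Tree k → Tree → Store 3
  store ρ s = ⟨ ρ ⟩ ∷ s ∷ ⟨ V ⟩ ∷ []

  mutual
    compile-run : ∀ {k} {ρ : Vec Tree k} {t v} → _⊢_⇓_ V ρ t v → ∀ s →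
                  Run (compile t) (store ρ s) (bound n (compile t)) (store ρ (v ∙ s))
    compile-run {ρ = ρ} (var {x = x}) s =
      subst (λ v → Run (compile (var x)) (store ρ s) (bound n (compile (var x))) (store ρ (v ∙ s)))
            (eval-path ρ x refl) run-assign
    compile-run nil        s = run-assign
    compile-run (cons a b) s = compile-run a s ⨾ compile-run b _ ⨾ run-assign
    compile-run (hd a)     s = compile-run a s ⨾ run-assign
    compile-run (tl a)     s = compile-run a s ⨾ run-assign
    compile-run (ifT {c = c} a b) s =
      compile-run a s ⨾
      run-ifTrue {b = bound n (1F := tl stk ⨟ compile c)} refl (run-assign ⨾ compile-run b s)
    compile-run (ifF {b = b} a c) s =
      compile-run a s ⨾
      run-ifFalse {a = bound n (1F := tl stk ⨟ compile b)} refl (run-assign ⨾ compile-run c s)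
    compile-run (let′ a b) s = compile-run a s ⨾ run-assign ⨾ run-assign ⨾ compile-run b s ⨾ run-assign
    compile-run (fold a l) s = compile-run a s ⨾ run-assign ⨾ fold-run l s ⨾ run-assign

    -- The constant 3 is the price of testing `hd stk`, paid once per row and once more on exit.
    fold-run : ∀ {k} {ρ : Vec Tree k} {b m} {xs : Vec Tree m} {u v} → Loop V ρ b xs u v → ∀ s →
               Run (while hd stk loop foldBody b) (store ρ (⟨ xs ⟩ ∙ u ∙ s))
                   (m * (3 + bound n (foldBody b)) + 3) (store ρ (nil ∙ v ∙ s))
    fold-run done s = run-stop refl
    fold-run {b = b} {m = suc m} (next d l) s =
      run-weaken (≤-reflexive (cong (3 +_) (sym (+-assoc (bound n (foldBody b)) (m * _) 3))))
        (run-loop refl (run-assign ⨾ run-assign ⨾ compile-run d _ ⨾ run-assign ⨾ run-assign)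
                       (fold-run l s))

-- Running times as powers of a common base

-- The exponent that the rules `+-≤^` and `*-≤^` assign to `bound`. It depends on the command alone
-- and not on the number of iterations, hence is a constant for a fixed program.
degree : ∀ {k} → Command k → ℕ
degree (x := e)              = 1 + cost e
degree (c ⨟ d)               = 1 + (degree c + degree d)
degree (if e then c else d)  = 1 + (1 + cost e + (1 + (degree c + degree d)))
degree (while e loop c)      = 1 + (1 + (1 + (1 + cost e + degree c)) + (1 + cost e))
degree (output e)            = cost e

module Powers {N : ℕ} (2≤N : 2 ≤ N) where

  infix 4 _≤^_
  -- A record keeps the exponent visible to unification; it could not be recovered from the number
  -- `N ^ e`.
  record _≤^_ (a e : ℕ) : Set where
    constructor power
    field ≤-power : a ≤ N ^ e

  instance
    N≢0 : NonZero N
    N≢0 = >-nonZero (≤-trans (s≤s z≤n) 2≤N)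

  double≤^ : ∀ e → N ^ e + N ^ e ≤ N ^ (1 + e)
  double≤^ e = begin
    N ^ e + N ^ e   ≡⟨ cong (N ^ e +_) (sym (+-identityʳ _)) ⟩
    2 * N ^ e       ≤⟨ *-monoˡ-≤ (N ^ e) 2≤N ⟩
    N * N ^ e       ∎
    where open ≤-Reasoning

  +-≤^ : ∀ {a b i j} → a ≤^ i → b ≤^ j → a + b ≤^ 1 + (i + j)
  +-≤^ {i = i} {j} (power a≤) (power b≤) = power (≤-trans
    (+-mono-≤ (≤-trans a≤ (^-monoʳ-≤ N (m≤m+n i j))) (≤-trans b≤ (^-monoʳ-≤ N (m≤n+m j i))))
    (double≤^ (i + j)))

  *-≤^ : ∀ {a b i j} → a ≤^ i → b ≤^ j → a * b ≤^ i + j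
  *-≤^ {i = i} {j} (power a≤) (power b≤) =
    power (≤-trans (*-mono-≤ a≤ b≤) (≤-reflexive (sym (^-distribˡ-+-* N i j))))

  ≤^-self : ∀ m → m ≤^ m
  ≤^-self m = power (m≤N^m m)
    where
    m≤N^m : ∀ m → m ≤ N ^ m
    m≤N^m zero    = z≤n
    m≤N^m (suc m) = ≤-trans (+-mono-≤ (m^n>0 N m) (m≤N^m m)) (double≤^ m)

  ≤⇒≤^1 : ∀ {m} → m ≤ N → m ≤^ 1
  ≤⇒≤^1 m≤N = power (≤-trans m≤N (≤-reflexive (sym (*-identityʳ N))))

  bound≤^degree : ∀ {k n} (c : Command k) → n ≤ N → bound n c ≤^ degree c
  bound≤^degree (x := e)             n≤N = ≤^-self (1 + cost e)
  bound≤^degree (c ⨟ d)              n≤N = +-≤^ (bound≤^degree c n≤N) (bound≤^degree d n≤N)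
  bound≤^degree (if e then c else d) n≤N =
    +-≤^ (≤^-self (1 + cost e)) (+-≤^ (bound≤^degree c n≤N) (bound≤^degree d n≤N))
  bound≤^degree (while e loop c)     n≤N =
    +-≤^ (*-≤^ (≤⇒≤^1 n≤N) (+-≤^ (≤^-self (1 + cost e)) (bound≤^degree c n≤N)))
         (≤^-self (1 + cost e))
  bound≤^degree (output e)           n≤N = ≤^-self (cost e)

-- The algorithm and its program

isTrue : Tree → Bool
isTrue nil     = false
isTrue (_ ∙ _) = true

bits : ∀ m → Tree → Subset m
bits zero    t = []
bits (suc m) t = isTrue (head t) ∷ bits m (tail t)

isTrue-encodeBool : ∀ b → isTrue (encodeBool b) ≡ b
isTrue-encodeBool false = refl
isTrue-encodeBool true  = refl

bits-encodeSubset : ∀ {m} (S : Subset m) → bits m (encodeSubset S) ≡ S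
bits-encodeSubset []      = refl
bits-encodeSubset (b ∷ S) = cong₂ _∷_ (isTrue-encodeBool b) (bits-encodeSubset S)

-- The characteristic vector of a vertex without its trailing zeros: bits reads
-- missing entries as false.
unit : ℕ → Tree
unit zero    = (nil ∙ nil) ∙ nil
unit (suc i) = nil ∙ unit i

bits-nil : ∀ m → bits m nil ≡ ⊥
bits-nil zero    = refl
bits-nil (suc m) = cong (false ∷_) (bits-nil m)

bits-unit : ∀ {m} (u : Fin m) → bits m (unit (toℕ u)) ≡ ⁅ u ⁆
bits-unit {suc m} zero    = cong (true ∷_) (bits-nil m)
bits-unit {suc m} (suc u) = cong (false ∷_) (bits-unit u)

bool : ∀ {k} → Bool → Term k
bool false = nil
bool true  = cons nil nil

table : ∀ {k} → (Bool → Bool → Bool) → Term k → Term k → Term k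
table f a b = ite a (ite b (bool (f true true))  (bool (f true false)))
                    (ite b (bool (f false true)) (bool (f false false)))

reverseBody : ∀ {k} → Term (2 + k)
reverseBody = cons (tl (hd (var 0F))) (cons (hd (hd (var 0F))) (tl (var 0F)))

zipBody : ∀ {k} → (Bool → Bool → Bool) → Term (2 + k)
zipBody f = cons (tl (hd (var 0F))) (cons (tl (hd (tl (var 0F))))
              (cons (table f (hd (hd (var 0F))) (hd (hd (tl (var 0F))))) (tl (tl (var 0F)))))

-- The first fold consumes one entry of both vectors per row and prepends the result, so its output
-- comes out backwards; the second fold reverses it.
zip : ∀ {k} → (Bool → Bool → Bool) → Fin k → Fin k → Term k
zip f x y = let′ (fold (cons (var x) (cons (var y) nil)) (zipBody f))
                 (tl (fold (cons (tl (tl (var 0F))) nil) reverseBody))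

someBody : ∀ {k} → Term (2 + k)
someBody = cons (tl (hd (var 0F))) (ite (hd (hd (var 0F))) (bool true) (tl (var 0F)))

someᵗ : ∀ {k} → Fin k → Term k
someᵗ x = tl (fold (cons (var x) nil) someBody)

_∖_ : Bool → Bool → Bool
b ∖ c = b ∧ not c

meets escapes : ∀ {k} → Fin k → Fin k → Term k
meets   x y = let′ (zip _∧_ x y) (someᵗ 0F)
escapes x y = let′ (zip _∖_ x y) (someᵗ 0F)

-- In the body, variable 0 is the accumulator, variable 1 the current vertex as a
-- singleton, and variable 3 its neighbourhood.
forVertices : ∀ {k} → Term k → Term (4 + k) → Term k
forVertices a b = hd (fold (cons a (cons (cons nil nil) nil))
  (let′ (tl (var 0F)) (let′ (hd (var 1F)) (cons b (cons nil (var 1F))))))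

roundᵗ : ∀ {k} → Fin k → Fin k → Term k
roundᵗ S K = forVertices (var K)
  (ite (meets 1F (4 ↑ʳ S))
       (ite (someᵗ 0F) (ite (meets 3F 0F) (zip _∨_ 0F 1F) (var 0F)) (zip _∨_ 0F 1F))
       (var 0F))

componentᵗ : ∀ {k} → Fin k → Term k
componentᵗ S = forVertices (zip (λ _ _ → false) S S) (roundᵗ (4 ↑ʳ S) 0F)

coversᵗ : ∀ {k} → Fin k → Term k
coversᵗ S = forVertices (bool true)
  (ite (meets 1F (4 ↑ʳ S)) (var 0F) (ite (escapes 3F (4 ↑ʳ S)) (bool false) (var 0F)))

isCVCᵗ : ∀ {k} → Fin k → Term k
isCVCᵗ S = ite (coversᵗ S)
  (let′ (componentᵗ S) (ite (escapes (suc S) 0F) (bool false) (bool true)))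
  (bool false)

minimiseᵗ : ∀ {k} → Fin k → Term k
minimiseᵗ S = forVertices (zip _∨_ S S)
  (let′ (zip _∖_ 0F 1F) (ite (isCVCᵗ 0F) (var 0F) (var 1F)))

successorsᵗ : ∀ {k} → Fin k → Term k
successorsᵗ X = forVertices nil
  (ite (meets 1F (4 ↑ʳ X))
       (cons (let′ (zip _∖_ (4 ↑ʳ X) 1F) (zip _∨_ 0F 4F)) (var 0F))
       (var 0F))

branchᵗ : ∀ {k} → Fin k → Fin k → Term k
branchᵗ S W = let′ (componentᵗ S) (let′ (zip _∖_ (1 ↑ʳ S) 0F)
  (forVertices (var (2 ↑ʳ W))
    (ite (meets 3F 5F)
         (ite (meets 3F 4F) (cons (zip _∨_ (6 ↑ʳ S) 1F) (var 0F)) (var 0F))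
         (var 0F))))

searchBody : ∀ {k} → Term (2 + k)
searchBody = cons (tl (hd (var 0F))) (ite (hd (hd (var 0F))) (tl (tl (var 0F))) (hd (tl (var 0F))))

searchᵗ : ∀ {k} → Fin k → Fin k → Term k
searchᵗ Y t = tl (fold (cons (var Y) (var t)) searchBody)

descendBody riseBody : ∀ {k} → Term (2 + k)
descendBody = cons (tl (hd (var 0F)))
  (ite (hd (hd (var 0F)))
       (cons (tl (hd (tl (var 0F)))) (cons (cons (bool true) (hd (hd (tl (var 0F))))) (tl (tl (var 0F)))))
       (cons (hd (hd (tl (var 0F)))) (cons (cons (bool false) (tl (hd (tl (var 0F))))) (tl (tl (var 0F))))))
riseBody = cons (tl (hd (var 0F)))
  (ite (hd (hd (hd (var 0F))))
       (cons (tl (hd (hd (var 0F)))) (tl (var 0F)))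
       (cons (tl (var 0F)) (tl (hd (hd (var 0F))))))

-- A fold cannot return through a recursion, so the insertion works with a zipper: going down it
-- records the siblings passed, going up it rebuilds the nodes from them.
insertᵗ : ∀ {k} → Fin k → Fin k → Term k
insertᵗ Y t = let′ (fold (cons (var Y) (cons (var t) nil)) descendBody)
                  (tl (fold (cons (tl (tl (var 0F))) (bool true)) riseBody))

triple : ∀ {k} → Term k → Term k → Term k → Term k
triple a b c = cons a (cons b (cons c nil))

-- The tree `nil` reads as a vector of length `n`; replacing each of its entries by true yields the
-- full vertex set.
initialᵗ : Term 0
initialᵗ = triple (cons (let′ nil (zip (λ _ _ → true) 0F 0F)) nil) nil nil

processᵗ : Term 3
processᵗ = let′ (hd (var 0F)) (ite (isCVCᵗ 0F)
  (let′ (minimiseᵗ 0F) (ite (searchᵗ 0F 4F)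
    (triple (tl (var 2F)) (var 3F) (var 4F))
    (triple (tl (var 2F)) (cons (var 0F) (var 3F)) (insertᵗ 0F 4F))))
  (let′ (tl (var 1F)) (triple (branchᵗ 1F 0F) (var 3F) (var 4F))))

expandᵗ : Term 3
expandᵗ = let′ (hd (var 1F)) (triple (successorsᵗ 0F) (tl (var 2F)) (var 3F))

-- The algorithm on subsets and tries

some : ∀ {m} → Subset m → Bool
some []      = false
some (b ∷ p) = b ∨ some p

search : ∀ {m} → Subset m → Tree → Tree
search []      t = t
search (b ∷ Y) t = search Y (ifᵇ b then tail t else head t)

insert : ∀ {m} → Subset m → Tree → Tree
insert []          t = nil ∙ nil
insert (true  ∷ Y) t = head t ∙ insert Y (tail t)
insert (false ∷ Y) t = insert Y (head t) ∙ tail t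

module Algorithm {n} (G : Graph (Fin n)) where

  N : Fin n → Subset n
  N u = tabulate (adj G u)

  -- An empty `K` accepts any vertex of `S`, which chooses the start of the component; from then on
  -- a vertex enters only through a neighbour in `K`.
  grow : Subset n → Subset n → Fin n → Subset n
  grow S K u =
    ifᵇ some (⁅ u ⁆ ∩ S)
    then (ifᵇ some K then (ifᵇ some (N u ∩ K) then K ∪ ⁅ u ⁆ else K) else K ∪ ⁅ u ⁆)
    else K

  round : Subset n → Subset n → Subset n
  round S K = foldl (grow S) K (allFin n)

  component : Subset n → Subset n
  component S = foldl (λ K _ → round S K) ⊥ (allFin n)

  cover : Subset n → Bool → Fin n → Bool
  cover S b u = ifᵇ some (⁅ u ⁆ ∩ S) then b else (ifᵇ some (N u ─ S) then false else b)

  covers isCVC : Subset n → Bool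
  covers S = foldl (cover S) true (allFin n)
  isCVC S  =
    ifᵇ covers S then (ifᵇ some (S ─ component S) then false else true) else false

  shrink : Subset n → Fin n → Subset n
  shrink S u = ifᵇ isCVC (S ─ ⁅ u ⁆) then S ─ ⁅ u ⁆ else S

  -- `S ∪ S` equals `S`, but computing it produces a canonical encoding, whereas the tree holding
  -- `S` need only decode to `S`.
  minimise : Subset n → Subset n
  minimise S = foldl shrink (S ∪ S) (allFin n)

  successor : Subset n → List (Subset n) → Fin n → List (Subset n)
  successor X W u = ifᵇ some (⁅ u ⁆ ∩ X) then (((X ─ ⁅ u ⁆) ∪ N u) ∷ W) else W

  successors : Subset n → List (Subset n)
  successors X = foldl (successor X) [] (allFin n)

  extend : Subset n → Subset n → List (Subset n) → Fin n → List (Subset n)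
  extend S K W u =
    ifᵇ some (N u ∩ K)
    then (ifᵇ some (N u ∩ (S ─ K)) then ((S ∪ ⁅ u ⁆) ∷ W) else W)
    else W

  branch : Subset n → List (Subset n) → List (Subset n)
  branch S W = foldl (extend S (component S)) W (allFin n)

  -- The sets still to be repaired, the covers still to be output, and a trie
  -- holding the covers found so far.
  State : Set
  State = List (Subset n) × List (Subset n) × Tree

  -- Repetition is tested when a cover is found, not when it is output, so a cover joins the waiting
  -- list at most once.
  process : Subset n → State → State
  process S (W , X , t) =
    ifᵇ isCVC S
    then (ifᵇ isTrue (search (minimise S) t)
          then (W , X , t)
          else (W , minimise S ∷ X , insert (minimise S) t))
    else (branch S W , X , t)

-- Evaluation of the set and trie operations

module Semantics {n} (V : Vec Tree n) where

  infix 3 _⊩_⇓_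
  _⊩_⇓_ : ∀ {k} → Vec Tree k → Term k → Tree → Set
  _⊩_⇓_ = _⊢_⇓_ V

  infix 4 _[_]↦_
  _[_]↦_ : ∀ {k} → Vec Tree k → Fin k → Subset n → Set
  ρ [ x ]↦ S = bits n (lookup ρ x) ≡ S

  cast-⇓ : ∀ {k} {ρ : Vec Tree k} {a s t} → s ≡ t → ρ ⊩ a ⇓ s → ρ ⊩ a ⇓ t
  cast-⇓ refl d = d

  cast-loop : ∀ {k m} {ρ : Vec Tree k} {b} {xs : Vec Tree m} {u v w} → v ≡ w →
              Loop V ρ b xs u v → Loop V ρ b xs u w
  cast-loop refl l = l

  bool-⇓ : ∀ {k} {ρ : Vec Tree k} b → ρ ⊩ bool b ⇓ encodeBool b
  bool-⇓ false = nil
  bool-⇓ true  = cons nil nil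

  if-⇓ : ∀ {A : Set} (f : A → Tree) {k} {ρ : Vec Tree k} {a b c s x y} →
         ρ ⊩ a ⇓ s → ρ ⊩ b ⇓ f x → ρ ⊩ c ⇓ f y → ρ ⊩ ite a b c ⇓ f (ifᵇ isTrue s then x else y)
  if-⇓ f {s = nil}   da db dc = ifF da dc
  if-⇓ f {s = _ ∙ _} da db dc = ifT da db

  ite-⇓ : ∀ {A : Set} (f : A → Tree) {k} {ρ : Vec Tree k} {a b c x y} p →
          ρ ⊩ a ⇓ encodeBool p → ρ ⊩ b ⇓ f x → ρ ⊩ c ⇓ f y →
          ρ ⊩ ite a b c ⇓ f (ifᵇ p then x else y)
  ite-⇓ f true  da db dc = ifT da db
  ite-⇓ f false da db dc = ifF da dc

  table-⇓ : ∀ {k} {ρ : Vec Tree k} f {a b s t} → ρ ⊩ a ⇓ s → ρ ⊩ b ⇓ t →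
            ρ ⊩ table f a b ⇓ encodeBool (f (isTrue s) (isTrue t))
  table-⇓ f {s = nil}   {nil}   da db = ifF da (ifF db (bool-⇓ _))
  table-⇓ f {s = nil}   {_ ∙ _} da db = ifF da (ifT db (bool-⇓ _))
  table-⇓ f {s = _ ∙ _} {nil}   da db = ifT da (ifF db (bool-⇓ _))
  table-⇓ f {s = _ ∙ _} {_ ∙ _} da db = ifT da (ifT db (bool-⇓ _))

  private
    bs : List Bool → Tree
    bs = encodeList encodeBool

  zip-loop : ∀ {k} {ρ : Vec Tree k} f {m} (xs : Vec Tree m) s t o → ∃₂ λ s′ t′ →
             Loop V ρ (zipBody f) xs (s ∙ t ∙ bs o)
               (s′ ∙ t′ ∙ bs (toList (zipWith f (bits m s) (bits m t)) ʳ++ o))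
  zip-loop f []       s t o = s , t , done
  zip-loop f (x ∷ xs) s t o with zip-loop f xs (tail s) (tail t) (f (isTrue (head s)) (isTrue (head t)) ∷ o)
  ... | s′ , t′ , l = s′ , t′ ,
    next (cons (tl (hd var)) (cons (tl (hd (tl var)))
           (cons (table-⇓ f (hd (hd var)) (hd (hd (tl var)))) (tl (tl var))))) l

  reverse-loop : ∀ {k} {ρ : Vec Tree k} {m} (xs : Vec Tree m) bs′ o → length bs′ ≡ m →
                 Loop V ρ reverseBody xs (bs bs′ ∙ bs o) (nil ∙ bs (bs′ ʳ++ o))
  reverse-loop []       []        o eq = done
  reverse-loop (x ∷ xs) (b ∷ bs′) o eq =
    next (cons (tl (hd var)) (cons (hd (hd var)) (tl var)))
         (reverse-loop xs bs′ (b ∷ o) (suc-injective eq))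

  zip-⇓ : ∀ {k} {ρ : Vec Tree k} f {x y S T} → ρ [ x ]↦ S → ρ [ y ]↦ T →
          ρ ⊩ zip f x y ⇓ encodeSubset (zipWith f S T)
  zip-⇓ {ρ = ρ} f {x} {y} refl refl with zip-loop {ρ = ρ} f V (lookup ρ x) (lookup ρ y) []
  ... | s′ , t′ , l =
    let′ (fold (cons var (cons var nil)) l)
      (tl (fold (cons (tl (tl var)) nil)
        (cast-loop (cong (λ o → nil ∙ bs o) (reverse-involutive zs))
          (reverse-loop V (List.reverse zs) []
            (trans (length-reverse zs) (length-toList ys))))))
    where
    ys = zipWith f (bits n (lookup ρ x)) (bits n (lookup ρ y))
    zs = toList ys

  some-loop : ∀ {k} {ρ : Vec Tree k} {m} (xs : Vec Tree m) s b → ∃ λ s′ →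
              Loop V ρ someBody xs (s ∙ encodeBool b) (s′ ∙ encodeBool (b ∨ some (bits m s)))
  some-loop [] s false = s , done
  some-loop [] s true  = s , done
  some-loop {m = suc m} (x ∷ xs) s b
    with some-loop xs (tail s) (ifᵇ isTrue (head s) then true else b)
  ... | s′ , l = s′ , next (cons (tl (hd var))
                    (cast-⇓ (if-encode (isTrue (head s))) (if-⇓ id (hd (hd var)) (bool-⇓ true) (tl var))))
                    (cast-loop (cong (λ c → s′ ∙ encodeBool c) (if-∨ (isTrue (head s)) b)) l)
    where
    if-encode : ∀ c → (ifᵇ c then nil ∙ nil else encodeBool b) ≡ encodeBool (ifᵇ c then true else b)
    if-encode false = refl
    if-encode true  = refl
    if-∨ : ∀ c b {d} → (ifᵇ c then true else b) ∨ d ≡ b ∨ (c ∨ d)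
    if-∨ false b     = refl
    if-∨ true  false = refl
    if-∨ true  true  = refl

  some-⇓ : ∀ {k} {ρ : Vec Tree k} {x S} → ρ [ x ]↦ S → ρ ⊩ someᵗ x ⇓ encodeBool (some S)
  some-⇓ {ρ = ρ} {x} refl = tl (fold (cons var nil) (proj₂ (some-loop V (lookup ρ x) false)))

  meets-⇓ : ∀ {k} {ρ : Vec Tree k} {x y} {S T : Subset n} → ρ [ x ]↦ S → ρ [ y ]↦ T →
            ρ ⊩ meets x y ⇓ encodeBool (some (S ∩ T))
  meets-⇓ {S = S} {T} p q = let′ (zip-⇓ _∧_ p q) (some-⇓ (bits-encodeSubset (S ∩ T)))

  ∖-⇓ : ∀ {k} {ρ : Vec Tree k} {x y S T} → ρ [ x ]↦ S → ρ [ y ]↦ T →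
        ρ ⊩ zip _∖_ x y ⇓ encodeSubset (S ─ T)
  ∖-⇓ {S = S} {T} p q = cast-⇓ (cong encodeSubset (∖-─ S T)) (zip-⇓ _∖_ p q)
    where
    ∖-─ : ∀ {m} (S T : Subset m) → zipWith _∖_ S T ≡ S ─ T
    ∖-─ []      []          = refl
    ∖-─ (false ∷ S) (false ∷ T) = cong (false ∷_) (∖-─ S T)
    ∖-─ (false ∷ S) (true  ∷ T) = cong (false ∷_) (∖-─ S T)
    ∖-─ (true  ∷ S) (false ∷ T) = cong (true  ∷_) (∖-─ S T)
    ∖-─ (true  ∷ S) (true  ∷ T) = cong (false ∷_) (∖-─ S T)

  escapes-⇓ : ∀ {k} {ρ : Vec Tree k} {x y S T} → ρ [ x ]↦ S → ρ [ y ]↦ T →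
              ρ ⊩ escapes x y ⇓ encodeBool (some (S ─ T))
  escapes-⇓ {S = S} {T} p q = let′ (∖-⇓ p q) (some-⇓ (bits-encodeSubset (S ─ T)))

  search-loop : ∀ {k} {ρ : Vec Tree k} {m} (xs : Vec Tree m) s t → ∃ λ s′ →
              Loop V ρ searchBody xs (s ∙ t) (s′ ∙ search (bits m s) t)
  search-loop []       s t = s , done
  search-loop (x ∷ xs) s t with search-loop xs (tail s) (ifᵇ isTrue (head s) then tail t else head t)
  ... | s′ , l = s′ , next (cons (tl (hd var)) (if-⇓ id (hd (hd var)) (tl (tl var)) (hd (tl var)))) l

  search-⇓ : ∀ {k} {ρ : Vec Tree k} {x y S} → ρ [ x ]↦ S →
           ρ ⊩ searchᵗ x y ⇓ search S (lookup ρ y)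
  search-⇓ {ρ = ρ} {x} {y} refl = tl (fold (cons var var) (proj₂ (search-loop V (lookup ρ x) (lookup ρ y))))

  encodeStep : Bool × Tree → Tree
  encodeStep (b , t) = encodeBool b ∙ t

  -- A path from a node of the trie to its root, with the siblings passed.
  Path : Set
  Path = List (Bool × Tree)

  climb : Path → Tree → Tree
  climb []                t = t
  climb ((true  , s) ∷ p) t = climb p (s ∙ t)
  climb ((false , s) ∷ p) t = climb p (t ∙ s)

  descend : ∀ {m} → Subset m → Tree → Path → Path
  descend []      t p = p
  descend (b ∷ Y) t p =
    descend Y (ifᵇ b then tail t else head t) ((b , (ifᵇ b then head t else tail t)) ∷ p)

  climb-descend : ∀ {m} (Y : Subset m) t p → climb (descend Y t p) (nil ∙ nil) ≡ climb p (insert Y t)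
  climb-descend []          t p = refl
  climb-descend (true  ∷ Y) t p = climb-descend Y (tail t) _
  climb-descend (false ∷ Y) t p = climb-descend Y (head t) _

  length-descend : ∀ {m} (Y : Subset m) t p → length (descend Y t p) ≡ m + length p
  length-descend []      t p = refl
  length-descend (b ∷ Y) t p = trans (length-descend Y _ _) (+-suc _ (length p))

  descend-loop : ∀ {k} {ρ : Vec Tree k} {m} (xs : Vec Tree m) s t p → ∃₂ λ s′ t′ →
                 Loop V ρ descendBody xs (s ∙ t ∙ encodeList encodeStep p)
                   (s′ ∙ t′ ∙ encodeList encodeStep (descend (bits m s) t p))
  descend-loop []       s t p = s , t , done
  descend-loop (x ∷ xs) s t p with head s in eq
  ... | nil with descend-loop xs (tail s) (head t) ((false , tail t) ∷ p)
  ...   | s′ , t′ , l = s′ , t′ ,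
    next (cons (tl (hd var)) (ifF (cast-⇓ eq (hd (hd var)))
      (cons (hd (hd (tl var))) (cons (cons nil (tl (hd (tl var)))) (tl (tl var)))))) l
  descend-loop (x ∷ xs) s t p | _ ∙ _ with descend-loop xs (tail s) (tail t) ((true , head t) ∷ p)
  ...   | s′ , t′ , l = s′ , t′ ,
    next (cons (tl (hd var)) (ifT (cast-⇓ eq (hd (hd var)))
      (cons (tl (hd (tl var))) (cons (cons (cons nil nil) (hd (hd (tl var)))) (tl (tl var)))))) l

  rise-loop : ∀ {k} {ρ : Vec Tree k} {m} (xs : Vec Tree m) p t → length p ≡ m →
              Loop V ρ riseBody xs (encodeList encodeStep p ∙ t) (nil ∙ climb p t)
  rise-loop []       []                t eq = done
  rise-loop (x ∷ xs) ((true  , s) ∷ p) t eq =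
    next (cons (tl (hd var)) (ifT (hd (hd (hd var))) (cons (tl (hd (hd var))) (tl var))))
         (rise-loop xs p (s ∙ t) (suc-injective eq))
  rise-loop (x ∷ xs) ((false , s) ∷ p) t eq =
    next (cons (tl (hd var)) (ifF (hd (hd (hd var))) (cons (tl var) (tl (hd (hd var))))))
         (rise-loop xs p (t ∙ s) (suc-injective eq))

  insert-⇓ : ∀ {k} {ρ : Vec Tree k} {x y S} → ρ [ x ]↦ S →
             ρ ⊩ insertᵗ x y ⇓ insert S (lookup ρ y)
  insert-⇓ {ρ = ρ} {x} {y} refl with descend-loop {ρ = ρ} V (lookup ρ x) (lookup ρ y) []
  ... | s′ , t′ , l =
    let′ (fold (cons var (cons var nil)) l)
      (tl (fold (cons (tl (tl var)) (cons nil nil))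
        (cast-loop (cong (nil ∙_) (climb-descend Y (lookup ρ y) []))
          (rise-loop V (descend Y (lookup ρ y) []) (nil ∙ nil)
            (trans (length-descend Y _ []) (+-identityʳ n))))))
    where Y = bits n (lookup ρ x)

-- Evaluation of the graph operations

module Correctness {n} (G : Graph (Fin n)) where

  open Algorithm G

  row : Fin n → Tree
  row u = encodeSubset (N u)

  open Semantics (tabulate row)

  -- The induction runs over final segments of the vertices: `g` lists those still to come, and `i`
  -- is the index of the first of them.
  vertices-loop : ∀ {k} {ρ : Vec Tree k} {b} {A : Set} {f : A → Fin n → A} (enc : A → Tree) →
    (∀ a u q → enc a ∷ unit (toℕ u) ∷ q ∷ row u ∷ ρ ⊩ b ⇓ enc (f a u)) →
    ∀ {m} i (g : Fin m → Fin n) → (∀ j → toℕ (g j) ≡ i + toℕ j) → ∀ a → ∃ λ i′ →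
    Loop (tabulate row) ρ
      (let′ (tl (var 0F)) (let′ (hd (var 1F)) (cons b (cons nil (var 1F)))))
      (tabulate (row ∘ g)) (enc a ∙ unit i) (enc (foldl f a (List.tabulate g)) ∙ i′)
  vertices-loop enc d {zero}  i g eq a = unit i , done
  vertices-loop {ρ = ρ} {f = f} enc d {suc m} i g eq a
    with vertices-loop enc d (suc i) (g ∘ suc) (λ j → trans (eq (suc j)) (+-suc i (toℕ j))) (f a (g zero))
  ... | i′ , l = i′ , next (let′ (tl var) (let′ (hd var) (cons
    (subst (λ e → enc a ∷ unit e ∷ (enc a ∙ unit i) ∷ row (g zero) ∷ ρ ⊩ _ ⇓ _)
           (trans (eq zero) (+-identityʳ i)) (d a (g zero) _))
    (cons nil var)))) l

  forVertices-⇓ : ∀ {k} {ρ : Vec Tree k} {a b} {A : Set} {f : A → Fin n → A} {x} (enc : A → Tree) →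
    ρ ⊩ a ⇓ enc x →
    (∀ a u q → enc a ∷ unit (toℕ u) ∷ q ∷ row u ∷ ρ ⊩ b ⇓ enc (f a u)) →
    ρ ⊩ forVertices a b ⇓ enc (foldl f x (allFin n))
  forVertices-⇓ {x = x} enc da db =
    hd (fold (cons da (cons (cons nil nil) nil)) (proj₂ (vertices-loop enc db 0 id (λ _ → refl) x)))

  round-⇓ : ∀ {k} {ρ : Vec Tree k} {x y S K} → ρ [ x ]↦ S → lookup ρ y ≡ encodeSubset K →
            ρ ⊩ roundᵗ x y ⇓ encodeSubset (round S K)
  round-⇓ {S = S} {K} p q =
    forVertices-⇓ {f = grow S} encodeSubset (cast-⇓ q var) λ K′ u r →
      ite-⇓ encodeSubset (some (⁅ u ⁆ ∩ S)) (meets-⇓ (bits-unit u) p)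
        (ite-⇓ encodeSubset (some K′) (some-⇓ (bits-encodeSubset K′))
          (ite-⇓ encodeSubset (some (N u ∩ K′)) (meets-⇓ (bits-encodeSubset (N u)) (bits-encodeSubset K′))
            (zip-⇓ _∨_ (bits-encodeSubset K′) (bits-unit u)) var)
          (zip-⇓ _∨_ (bits-encodeSubset K′) (bits-unit u)))
        var

  component-⇓ : ∀ {k} {ρ : Vec Tree k} {x S} → ρ [ x ]↦ S →
                ρ ⊩ componentᵗ x ⇓ encodeSubset (component S)
  component-⇓ {S = S} p =
    forVertices-⇓ {f = λ K _ → round S K} encodeSubset
      (cast-⇓ (cong encodeSubset (empty S)) (zip-⇓ (λ _ _ → false) p p))
      λ K u r → round-⇓ p refl
    where
    empty : ∀ {m} (S : Subset m) → zipWith (λ _ _ → false) S S ≡ ⊥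
    empty []      = refl
    empty (b ∷ S) = cong (false ∷_) (empty S)

  covers-⇓ : ∀ {k} {ρ : Vec Tree k} {x S} → ρ [ x ]↦ S → ρ ⊩ coversᵗ x ⇓ encodeBool (covers S)
  covers-⇓ {S = S} p = forVertices-⇓ {f = cover S} encodeBool (bool-⇓ true) λ b u r →
    ite-⇓ encodeBool (some (⁅ u ⁆ ∩ S)) (meets-⇓ (bits-unit u) p) var
      (ite-⇓ encodeBool (some (N u ─ S)) (escapes-⇓ (bits-encodeSubset (N u)) p) (bool-⇓ false) var)

  isCVC-⇓ : ∀ {k} {ρ : Vec Tree k} {x S} → ρ [ x ]↦ S → ρ ⊩ isCVCᵗ x ⇓ encodeBool (isCVC S)
  isCVC-⇓ {S = S} p =
    ite-⇓ encodeBool (covers S) (covers-⇓ p)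
      (let′ (component-⇓ p)
        (ite-⇓ encodeBool (some (S ─ component S)) (escapes-⇓ p (bits-encodeSubset (component S)))
          (bool-⇓ false) (bool-⇓ true)))
      (bool-⇓ false)

  minimise-⇓ : ∀ {k} {ρ : Vec Tree k} {x S} → ρ [ x ]↦ S →
               ρ ⊩ minimiseᵗ x ⇓ encodeSubset (minimise S)
  minimise-⇓ {S = S} p = forVertices-⇓ {f = shrink} encodeSubset (zip-⇓ _∨_ p p) λ T u r →
    let′ (∖-⇓ (bits-encodeSubset T) (bits-unit u))
      (ite-⇓ encodeSubset (isCVC (T ─ ⁅ u ⁆)) (isCVC-⇓ (bits-encodeSubset (T ─ ⁅ u ⁆))) var var)

  encodeSubsets : List (Subset n) → Tree
  encodeSubsets = encodeList encodeSubset

  successors-⇓ : ∀ {k} {ρ : Vec Tree k} {x X} → ρ [ x ]↦ X →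
                 ρ ⊩ successorsᵗ x ⇓ encodeSubsets (successors X)
  successors-⇓ {X = X} p = forVertices-⇓ {f = successor X} {x = []} encodeSubsets nil λ W u r →
    ite-⇓ encodeSubsets {x = ((X ─ ⁅ u ⁆) ∪ N u) ∷ W} {y = W} (some (⁅ u ⁆ ∩ X))
      (meets-⇓ (bits-unit u) p)
      (cons (let′ (∖-⇓ p (bits-unit u))
              (zip-⇓ _∨_ (bits-encodeSubset (X ─ ⁅ u ⁆)) (bits-encodeSubset (N u))))
            var)
      var

  branch-⇓ : ∀ {k} {ρ : Vec Tree k} {x y S W} → ρ [ x ]↦ S → lookup ρ y ≡ encodeSubsets W →
             ρ ⊩ branchᵗ x y ⇓ encodeSubsets (branch S W)
  branch-⇓ {S = S} {W} p q = let′ (component-⇓ p) (let′ (∖-⇓ p (bits-encodeSubset K))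
    (forVertices-⇓ {f = extend S K} {x = W} encodeSubsets (cast-⇓ q var) λ W′ u r →
      ite-⇓ encodeSubsets {y = W′} (some (N u ∩ K))
        (meets-⇓ (bits-encodeSubset (N u)) (bits-encodeSubset K))
        (ite-⇓ encodeSubsets {x = (S ∪ ⁅ u ⁆) ∷ W′} {y = W′} (some (N u ∩ (S ─ K)))
          (meets-⇓ (bits-encodeSubset (N u)) (bits-encodeSubset (S ─ K)))
          (cons (zip-⇓ _∨_ p (bits-unit u)) var) var)
        var))
    where K = component S

  environment : State → Vec Tree 3
  environment (W , X , t) = encodeSubsets W ∷ encodeSubsets X ∷ t ∷ []

  encodeState : State → Tree
  encodeState st = ⟨ environment st ⟩

  triple-⇓ : ∀ {k} {ρ : Vec Tree k} {a b c} st → ρ ⊩ a ⇓ encodeSubsets (proj₁ st) →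
             ρ ⊩ b ⇓ encodeSubsets (proj₁ (proj₂ st)) → ρ ⊩ c ⇓ proj₂ (proj₂ st) →
             ρ ⊩ triple a b c ⇓ encodeState st
  triple-⇓ st da db dc = cons da (cons db (cons dc nil))

  process-⇓ : ∀ S W X t → environment (S ∷ W , X , t) ⊩ processᵗ ⇓ encodeState (process S (W , X , t))
  process-⇓ S W X t = let′ (hd var) (ite-⇓ encodeState (isCVC S) (isCVC-⇓ (bits-encodeSubset S))
    (let′ (minimise-⇓ (bits-encodeSubset S))
      (if-⇓ encodeState (search-⇓ (bits-encodeSubset (minimise S)))
        (triple-⇓ (W , X , t) (tl var) var var)
        (triple-⇓ (W , minimise S ∷ X , insert (minimise S) t) (tl var) (cons var var)
          (insert-⇓ (bits-encodeSubset (minimise S))))))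
    (let′ (tl var) (triple-⇓ (branch S W , X , t) (branch-⇓ {W = W} (bits-encodeSubset S) refl) var var)))

  expand-⇓ : ∀ X Xs t → environment ([] , X ∷ Xs , t) ⊩ expandᵗ ⇓ encodeState (successors X , Xs , t)
  expand-⇓ X Xs t = let′ (hd var)
    (triple-⇓ (successors X , Xs , t) (successors-⇓ (bits-encodeSubset X)) (tl var) var)

  initial-⇓ : [] ⊩ initialᵗ ⇓ encodeState (⊤ ∷ [] , [] , nil)
  initial-⇓ = triple-⇓ (⊤ ∷ [] , [] , nil)
    (cons (let′ nil (cast-⇓ (cong encodeSubset (full (bits n nil))) (zip-⇓ (λ _ _ → true) refl refl))) nil)
    nil nil
    where
    full : ∀ {m} (S : Subset m) → zipWith (λ _ _ → true) S S ≡ ⊤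
    full []      = refl
    full (b ∷ S) = cong (true ∷_) (full S)

  -- This is all that the timing argument uses of the three terms; it is generic in them, and their
  -- degrees enter it as parameters.
  record Implementation (init : Term 0) (proc exp : Term 3) : Set where
    field
      init-⇓ : [] ⊩ init ⇓ encodeState (⊤ ∷ [] , [] , nil)
      proc-⇓ : ∀ S W X t → environment (S ∷ W , X , t) ⊩ proc ⇓ encodeState (process S (W , X , t))
      exp-⇓  : ∀ X Xs t → environment ([] , X ∷ Xs , t) ⊩ exp ⇓ encodeState (successors X , Xs , t)

  implementation : Implementation initialᵗ processᵗ expandᵗ
  implementation = record { init-⇓ = initial-⇓ ; proc-⇓ = process-⇓ ; exp-⇓ = expand-⇓ }

-- Correctness of the algorithm on graphs

some-reflects : ∀ {m} (S : Subset m) → Reflects (Nonempty S) (some S)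
some-reflects []          = ofⁿ λ ()
some-reflects (true  ∷ S) = ofʸ (zero , here)
some-reflects (false ∷ S) with some S | some-reflects S
... | true  | ofʸ (x , x∈S) = ofʸ (suc x , there x∈S)
... | false | ofⁿ empty     = ofⁿ λ { (suc x , there x∈S) → empty (x , x∈S) }

∈-─⁻ : ∀ {m} {x : Fin m} (S T : Subset m) → x ∈ S ─ T → x ∈ S × x ∉ T
∈-─⁻ {x = x} S T x∈ = p─q⊆p S T x∈ , go S T x∈
  where
  go : ∀ {m} {x : Fin m} (S T : Subset m) → x ∈ S ─ T → x ∉ T
  go (_ ∷ S) (false ∷ T) here       ()
  go (_ ∷ S) (_ ∷ T)     (there x∈) (there x∈T) = go S T x∈ x∈T

⊆-∪-elim : ∀ {m} {S T U : Subset m} → S ⊆ U → T ⊆ U → S ∪ T ⊆ U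
⊆-∪-elim {S = S} {T} S⊆U T⊆U x∈ = [ S⊆U , T⊆U ]′ (x∈p∪q⁻ S T x∈)

⁅⁆⊆ : ∀ {m} {x : Fin m} {S} → x ∈ S → ⁅ x ⁆ ⊆ S
⁅⁆⊆ {x = x} x∈S y∈ with refl ← x∈⁅y⁆⇒x≡y x y∈ = x∈S

empty-─⇒⊆ : ∀ {m} {S T : Subset m} → Empty (S ─ T) → S ⊆ T
empty-─⇒⊆ {T = T} empty {x} x∈S with x ∈? T
... | yes x∈T = x∈T
... | no  x∉T = contradiction (x , x∈p∧x∉q⇒x∈p─q x∈S x∉T) empty

∣∣-grows : ∀ {m} {S T : Subset m} → S ⊆ T → S ≡ T ⊎ ∣ S ∣ ℕ.< ∣ T ∣
∣∣-grows {S = S} {T} S⊆T with nonempty? (T ─ S)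
... | yes (x , x∈) = let x∈T , x∉S = ∈-─⁻ T S x∈ in inj₂ (p⊂q⇒∣p∣<∣q∣ (S⊆T , x , x∈T , x∉S))
... | no  empty    = inj₁ (⊆-antisym S⊆T (empty-─⇒⊆ empty))

module Inflationary {n} (f : Subset n → Subset n) (inflates : ∀ K → K ⊆ f K) where

  iterate : ∀ {A : Set} → Subset n → List A → Subset n
  iterate = foldl (λ K _ → f K)

  iterate-fixed : ∀ {A : Set} {K} → f K ≡ K → (xs : List A) → iterate K xs ≡ K
  iterate-fixed eq []       = refl
  iterate-fixed eq (x ∷ xs) = trans (cong (λ K → iterate K xs) eq) (iterate-fixed eq xs)

  iterate-grows : ∀ {A : Set} K (xs : List A) →
    let R = iterate K xs in f R ≡ R ⊎ ∣ K ∣ + length xs ≤ ∣ R ∣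
  iterate-grows K []       = inj₂ (≤-reflexive (ℕ.+-identityʳ _))
  iterate-grows K (x ∷ xs) with ∣∣-grows (inflates K)
  ... | inj₁ K≡fK = inj₁ (subst (λ R → f R ≡ R) (sym (iterate-fixed (sym K≡fK) (x ∷ xs))) (sym K≡fK))
  ... | inj₂ K<fK = Sum.map₂
    (≤-trans (≤-trans (≤-reflexive (ℕ.+-suc ∣ K ∣ (length xs))) (ℕ.+-monoˡ-≤ (length xs) K<fK)))
    (iterate-grows (f K) xs)

  -- Every step that changes the set adds an element. So after `n` steps from the empty set, either
  -- a fixed point was reached or all `n` elements are present, and the full set cannot grow.
  iterate-stabilises : f (iterate ⊥ (allFin n)) ≡ iterate ⊥ (allFin n)
  iterate-stabilises with iterate-grows ⊥ (allFin n)
  ... | inj₁ eq = eq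
  ... | inj₂ le = subst (λ R → f R ≡ R) (sym R≡⊤) (⊆-antisym ⊆⊤ (inflates ⊤))
    where
    R≡⊤ : iterate ⊥ (allFin n) ≡ ⊤
    R≡⊤ = ∣p∣≡n⇒p≡⊤ (ℕ.≤-antisym (∣p∣≤n (iterate ⊥ (allFin n)))
      (≤-trans (≤-reflexive (sym (length-tabulate {n = n} id))) (≤-trans (m≤n+m _ ∣ ⊥ {n} ∣) le)))

module Collect {A B : Set} (P : A → Set) (g : A → B) (f : List B → A → List B)
  (spec : ∀ W u → (f W u ≡ W × ¬ P u) ⊎ (f W u ≡ g u ∷ W × P u)) where

  -- Common account of `branch` and `successors`: `few` limits the branching factor, `only`
  -- transfers properties to the new sets, and `complete` guarantees that no move is lost.
  record Collected (us : List A) (W R : List B) : Set where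
    field
      new      : List B
      split    : R ≡ new ++ W
      few      : length new ≤ length us
      only     : All (λ T → ∃ λ u → P u × T ≡ g u) new
      complete : ∀ {u} → u ∈ₗ us → P u → g u ∈ₗ new

  collect : ∀ us W → Collected us W (foldl f W us)
  collect []       W = record { new = [] ; split = refl ; few = z≤n ; only = [] ; complete = λ () }
  collect (u ∷ us) W with collect us (f W u) | spec W u
  ... | c | inj₁ (eq , ¬p) = record
    { new = new ; split = trans split (cong (new ++_) eq) ; few = ℕ.m≤n⇒m≤1+n few ; only = only
    ; complete = λ { (here refl) p → contradiction p ¬p ; (there u∈) p → complete u∈ p } }
    where open Collected c
  ... | c | inj₂ (eq , p) = record
    { new = new ++ g u ∷ []
    ; split = trans split (trans (cong (new ++_) eq) (sym (++-assoc new (g u ∷ []) W)))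
    ; few = ≤-trans (≤-reflexive (trans (length-++ new) (ℕ.+-comm _ 1))) (s≤s few)
    ; only = All.++⁺ only ((u , p , refl) ∷ [])
    ; complete = λ { (here refl) _ → ∈-++⁺ʳ new (here refl) ; (there u∈) q → ∈-++⁺ˡ (complete u∈ q) } }
    where open Collected c

module Graphs {n} (G : Graph (Fin n)) where

  open Algorithm G

  -- Neighbourhoods and paths

  ∈N⁺ : ∀ {u v} → Adj G u v → v ∈ N u
  ∈N⁺ {u} {v} a = lookup⇒[]= v (N u) (trans (lookup∘tabulate (adj G u) v) (Equivalence.to T-≡ a))

  ∈N⁻ : ∀ {u v} → v ∈ N u → Adj G u v
  ∈N⁻ {u} {v} v∈ = Equivalence.from T-≡ (trans (sym (lookup∘tabulate (adj G u) v)) ([]=⇒lookup v∈))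

  adj-sym : ∀ {u v} → Adj G u v → Adj G v u
  adj-sym {u} {v} = subst T (Graph.sym G u v)

  Link : Subset n → Fin n → Fin n → Set
  Link S x y = x ∈ S × y ∈ S × Adj G x y

  Path : Subset n → Fin n → Fin n → Set
  Path S = Star (Link S)

  path-sym : ∀ {S x y} → Path S x y → Path S y x
  path-sym = Star.reverse λ (x∈ , y∈ , a) → y∈ , x∈ , adj-sym a

  path-mono : ∀ {S T x y} → S ⊆ T → Path S x y → Path T x y
  path-mono S⊆T = Star.map λ (x∈ , y∈ , a) → S⊆T x∈ , S⊆T y∈ , a

  link : ∀ {S x y} → x ∈ S → y ∈ S → Adj G x y → Path S x y
  link x∈ y∈ a = (x∈ , y∈ , a) ◅ ε

  -- The vertices of `G [ S ]` carry membership proofs, so the empty path closes only because two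
  -- such proofs for the same vertex are equal.
  paths⇒connected : ∀ {S} → (∀ {x y} → x ∈ S → y ∈ S → Path S x y) → Connected (G [ S ])
  paths⇒connected {S} paths (x , x∈) (y , y∈) = go (paths x∈ y∈) x∈ y∈
    where
    go : ∀ {x y} → Path S x y → (p : x ∈ S) (q : y ∈ S) → Star (Adj (G [ S ])) (x , p) (y , q)
    go ε p q rewrite []=-irrelevant p q = ε
    go ((_ , z∈ , a) ◅ r) p q = a ◅ go r z∈ q

  connected⇒paths : ∀ {S} → Connected (G [ S ]) → ∀ {x y} → x ∈ S → y ∈ S → Path S x y
  connected⇒paths conn x∈ y∈ =
    Star.gmap proj₁ (λ { {_ , p} {_ , q} a → p , q , a }) (conn (_ , x∈) (_ , y∈))

  -- Components by repeated absorption

  grow-cases : ∀ S K u → grow S K u ≡ K ⊎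
    (grow S K u ≡ K ∪ ⁅ u ⁆ × u ∈ S × (Empty K ⊎ Nonempty (N u ∩ K)))
  grow-cases S K u with some (⁅ u ⁆ ∩ S) | some-reflects (⁅ u ⁆ ∩ S)
  ... | false | _ = inj₁ refl
  ... | true  | ofʸ (x , x∈) with x∈p∩q⁻ ⁅ u ⁆ S x∈
  ...   | x∈u , x∈S with refl ← x∈⁅y⁆⇒x≡y u x∈u with some K | some-reflects K
  ...     | false | ofⁿ empty = inj₂ (refl , x∈S , inj₁ empty)
  ...     | true  | _ with some (N u ∩ K) | some-reflects (N u ∩ K)
  ...       | false | _        = inj₁ refl
  ...       | true  | ofʸ meet = inj₂ (refl , x∈S , inj₂ meet)

  grow-absorbs : ∀ {S K u} → u ∈ S → Empty K ⊎ Nonempty (N u ∩ K) → u ∈ grow S K u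
  grow-absorbs {S} {K} {u} u∈S cond with some (⁅ u ⁆ ∩ S) | some-reflects (⁅ u ⁆ ∩ S)
  ... | false | ofⁿ empty = contradiction (u , x∈p∩q⁺ (x∈⁅x⁆ u , u∈S)) empty
  ... | true  | _ with some K | some-reflects K
  ...   | false | _ = q⊆p∪q K ⁅ u ⁆ (x∈⁅x⁆ u)
  ...   | true  | ofʸ inhabited with some (N u ∩ K) | some-reflects (N u ∩ K)
  ...     | true  | _          = q⊆p∪q K ⁅ u ⁆ (x∈⁅x⁆ u)
  ...     | false | ofⁿ apart = ⊥-elim ([ (λ empty → empty inhabited) , apart ]′ cond)

  grow-inflates : ∀ S K u → K ⊆ grow S K u
  grow-inflates S K u with grow-cases S K u
  ... | inj₁ eq       = ⊆-reflexive (sym eq)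
  ... | inj₂ (eq , _) = ⊆-trans (p⊆p∪q ⁅ u ⁆) (⊆-reflexive (sym eq))

  grows-inflate : ∀ S K us → K ⊆ foldl (grow S) K us
  grows-inflate S K []       = id
  grows-inflate S K (u ∷ us) = ⊆-trans (grow-inflates S K u) (grows-inflate S (grow S K u) us)

  round-inflates : ∀ S K → K ⊆ round S K
  round-inflates S K = grows-inflate S K (allFin n)

  -- All intermediate sets lie between `K` and the final result, which is `K` again.
  grows-fixed : ∀ {S K} us → foldl (grow S) K us ≡ K → ∀ {u} → u ∈ₗ us → grow S K u ≡ K
  grows-fixed {S} {K} (u ∷ us) eq u∈ with ⊆-antisym
    (⊆-trans (grows-inflate S (grow S K u) us) (⊆-reflexive eq)) (grow-inflates S K u) | u∈
  ... | fix | here refl = fix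
  ... | fix | there u∈′ = grows-fixed us (trans (cong (λ K → foldl (grow S) K us) (sym fix)) eq) u∈′

  Clustered : Subset n → Subset n → Set
  Clustered S K = K ⊆ S × (∀ {x y} → x ∈ K → y ∈ K → Path S x y)

  grow-clustered : ∀ {S K} u → Clustered S K → Clustered S (grow S K u)
  grow-clustered {S} {K} u (K⊆S , paths) with grow-cases S K u
  ... | inj₁ eq = subst (Clustered S) (sym eq) (K⊆S , paths)
  ... | inj₂ (eq , u∈S , cond) = subst (Clustered S) (sym eq)
    (⊆-∪-elim K⊆S (⁅⁆⊆ u∈S) , λ x∈ y∈ → join (x∈p∪q⁻ K _ x∈) (x∈p∪q⁻ K _ y∈))
    where
    toward : Empty K ⊎ Nonempty (N u ∩ K) → ∀ {x} → x ∈ K → Path S u x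
    toward (inj₁ empty)    x∈ = contradiction (_ , x∈) empty
    toward (inj₂ (z , z∈)) x∈ with x∈p∩q⁻ (N u) K z∈
    ... | z∈N , z∈K = link u∈S (K⊆S z∈K) (∈N⁻ z∈N) ◅◅ paths z∈K x∈
    join : ∀ {x y} → x ∈ K ⊎ x ∈ ⁅ u ⁆ → y ∈ K ⊎ y ∈ ⁅ u ⁆ → Path S x y
    join (inj₁ x∈) (inj₁ y∈) = paths x∈ y∈
    join (inj₁ x∈) (inj₂ y∈) with refl ← x∈⁅y⁆⇒x≡y u y∈ = path-sym (toward cond x∈)
    join (inj₂ x∈) (inj₁ y∈) with refl ← x∈⁅y⁆⇒x≡y u x∈ = toward cond y∈
    join (inj₂ x∈) (inj₂ y∈) with refl ← x∈⁅y⁆⇒x≡y u x∈ with refl ← x∈⁅y⁆⇒x≡y u y∈ = ε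

  grows-clustered : ∀ {S K} us → Clustered S K → Clustered S (foldl (grow S) K us)
  grows-clustered []       c = c
  grows-clustered (u ∷ us) c = grows-clustered us (grow-clustered u c)

  rounds-clustered : ∀ {A : Set} {S K} (xs : List A) → Clustered S K →
                     Clustered S (foldl (λ K _ → round S K) K xs)
  rounds-clustered []       c = c
  rounds-clustered (x ∷ xs) c = rounds-clustered xs (grows-clustered (allFin n) c)

  record IsComponent (S K : Subset n) : Set where
    field
      within    : K ⊆ S
      paths     : ∀ {x y} → x ∈ K → y ∈ K → Path S x y
      closed    : ∀ {x y} → x ∈ K → y ∈ S → Adj G x y → y ∈ K
      inhabited : Nonempty S → Nonempty K

    absorbs : ∀ {x y} → Path S x y → x ∈ K → y ∈ K
    absorbs ε                  x∈ = x∈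
    absorbs ((_ , z∈ , a) ◅ r) x∈ = absorbs r (closed x∈ z∈ a)

  component-isComponent : ∀ S → IsComponent S (component S)
  component-isComponent S = record
    { within    = proj₁ clustered
    ; paths     = proj₂ clustered
    ; closed    = λ x∈ y∈ a → absorbed y∈ (inj₂ (_ , x∈p∩q⁺ (∈N⁺ (adj-sym a) , x∈)))
    ; inhabited = λ (x , x∈) → nonempty x∈
    }
    where
    K = component S
    clustered : Clustered S K
    clustered = rounds-clustered (allFin n) ((λ x∈ → contradiction x∈ ∉⊥) , λ x∈ → contradiction x∈ ∉⊥)
    absorbed : ∀ {u} → u ∈ S → Empty K ⊎ Nonempty (N u ∩ K) → u ∈ K
    absorbed {u} u∈S cond = subst (u ∈_)
      (grows-fixed (allFin n) (Inflationary.iterate-stabilises (round S) (round-inflates S)) (∈-allFin u))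
      (grow-absorbs u∈S cond)
    nonempty : ∀ {x} → x ∈ S → Nonempty K
    nonempty x∈ with nonempty? K
    ... | yes inhabited = inhabited
    ... | no  empty     = _ , absorbed x∈ (inj₁ empty)

  component-exhausts : ∀ {S} → Empty (S ─ component S) → Connected (G [ S ])
  component-exhausts {S} empty = paths⇒connected λ x∈ y∈ → paths (inK x∈) (inK y∈)
    where
    open IsComponent (component-isComponent S)
    inK : ∀ {x} → x ∈ S → x ∈ component S
    inK = empty-─⇒⊆ empty

  -- Testing for connected vertex covers

  cover-false : ∀ S us → foldl (cover S) false us ≡ false
  cover-false S []       = refl
  cover-false S (u ∷ us) with some (⁅ u ⁆ ∩ S) | some (N u ─ S)
  ... | true  | _     = cover-false S us
  ... | false | true  = cover-false S us
  ... | false | false = cover-false S us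

  cover-sound : ∀ S us → T (foldl (cover S) true us) → ∀ {u} → u ∈ₗ us → u ∈ S ⊎ Empty (N u ─ S)
  cover-sound S (u ∷ us) t v∈ with some (⁅ u ⁆ ∩ S) | some-reflects (⁅ u ⁆ ∩ S)
                                 | some (N u ─ S) | some-reflects (N u ─ S)
  cover-sound S (u ∷ us) t (here refl) | true | ofʸ (x , x∈) | _ | _ with x∈p∩q⁻ ⁅ u ⁆ S x∈
  ... | x∈u , x∈S with refl ← x∈⁅y⁆⇒x≡y u x∈u = inj₁ x∈S
  cover-sound S (u ∷ us) t (there v∈) | true | _ | _ | _ = cover-sound S us t v∈
  cover-sound S (u ∷ us) t v∈ | false | _ | true | _ = contradiction (subst T (cover-false S us) t) λ ()
  cover-sound S (u ∷ us) t (here refl) | false | _ | false | ofⁿ empty = inj₂ empty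
  cover-sound S (u ∷ us) t (there v∈)  | false | _ | false | _ = cover-sound S us t v∈

  cover-complete : ∀ {S} → VertexCover G S → ∀ us → T (foldl (cover S) true us)
  cover-complete         vc []       = _
  cover-complete {S = S} vc (u ∷ us) with some (⁅ u ⁆ ∩ S) | some-reflects (⁅ u ⁆ ∩ S)
  ... | true  | _ = cover-complete vc us
  ... | false | ofⁿ u∉S with some (N u ─ S) | some-reflects (N u ─ S)
  ...   | false | _ = cover-complete vc us
  ...   | true  | ofʸ (x , x∈) with ∈-─⁻ (N u) S x∈
  ...     | x∈N , x∉S = ⊥-elim ([ (λ u∈S → u∉S (u , x∈p∩q⁺ (x∈⁅x⁆ u , u∈S))) , x∉S ]′ (vc u x (∈N⁻ x∈N)))

  covers-reflects : ∀ S → Reflects (VertexCover G S) (covers S)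
  covers-reflects S = fromEquivalence sound (λ vc → cover-complete vc (allFin n))
    where
    sound : T (covers S) → VertexCover G S
    sound t u v a =
      Sum.map₂ (λ empty → empty-─⇒⊆ empty (∈N⁺ a)) (cover-sound S (allFin n) t (∈-allFin u))

  isCVC-reflects : ∀ S → Reflects (ConnectedVertexCover G S) (isCVC S)
  isCVC-reflects S with covers S | covers-reflects S
  ... | false | ofⁿ ¬vc = ofⁿ (¬vc ∘ proj₁)
  ... | true  | ofʸ vc with some (S ─ component S) | some-reflects (S ─ component S)
  ...   | true  | ofʸ (x , x∈) = ofⁿ λ (_ , conn) →
    let x∈S , x∉K = ∈-─⁻ S _ x∈
        y , y∈K   = inhabited (x , x∈S)
    in x∉K (absorbs (connected⇒paths conn (within y∈K) x∈S) y∈K)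
    where open IsComponent (component-isComponent S)
  ...   | false | ofⁿ empty = ofʸ (vc , component-exhausts empty)

  -- A step of a path from K to S ∖ K inside a connected vertex cover U ⊇ S that
  -- leaves S returns to S immediately, because S is a vertex cover.
  bridge : ∀ {S K U} → VertexCover G S → IsComponent S K → S ⊆ U → Connected (G [ U ]) →
           Nonempty (S ─ K) → ∃ λ w → w ∈ U × Nonempty (N w ∩ K) × Nonempty (N w ∩ (S ─ K))
  bridge {S} {K} {U} vc comp S⊆U conn (b , b∈) = walk (connected⇒paths conn (S⊆U (within a∈K)) (S⊆U b∈S)) a∈K
    where
    open IsComponent comp
    b∈S = proj₁ (∈-─⁻ S K b∈)
    a∈K = proj₂ (inhabited (b , b∈S))
    walk : ∀ {x} → Path U x b → x ∈ K → ∃ λ w → w ∈ U × Nonempty (N w ∩ K) × Nonempty (N w ∩ (S ─ K))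
    walk ε x∈K = contradiction x∈K (proj₂ (∈-─⁻ S K b∈))
    walk {x} (_◅_ {j = y} (_ , y∈U , xy) r) x∈K with y ∈? K
    ... | yes y∈K = walk r y∈K
    ... | no  y∉K with r
    ...   | ε = contradiction (closed x∈K b∈S xy) y∉K
    ...   | _◅_ {j = z} (_ , z∈U , yz) r′ with z ∈? K
    ...     | yes z∈K = walk r′ z∈K
    ...     | no  z∉K with vc y z yz
    ...       | inj₁ y∈S = contradiction (closed x∈K y∈S xy) y∉K
    ...       | inj₂ z∈S = y , y∈U , (x , x∈p∩q⁺ (∈N⁺ (adj-sym xy) , x∈K)) ,
                           (z , x∈p∩q⁺ (∈N⁺ yz , x∈p∧x∉q⇒x∈p─q z∈S z∉K))

  -- Counting components by representatives

  Spans : Subset n → List (Fin n) → Set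
  Spans S L = ∀ {x} → x ∈ S → ∃ λ l → l ∈ₗ L × Path S x l

  -- G[S] has at most k components.
  Rank : Subset n → ℕ → Set
  Rank S k = ∃ λ L → length L ≤ k × Spans S L

  -- The new vertex `w` joins the component of `a` to that of `b`, so the representative `lb` can be
  -- deleted: everything it served now reaches `la` through `w`. The two representatives differ,
  -- since otherwise `b` would be absorbed into `K`. Since `lb` was in the list, `k` is a successor.
  rank-drops : ∀ {S K w k} → IsComponent S K → Nonempty (N w ∩ K) → Nonempty (N w ∩ (S ─ K)) →
               Rank S k → ∃ λ k′ → k ≡ suc k′ × Rank (S ∪ ⁅ w ⁆) k′
  rank-drops {S} {K} {w} comp (a , a∈) (b , b∈) (L , L≤k , spans) = shorten (<-≤-trans L′<L L≤k)
    where
    open IsComponent comp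
    a∈N = proj₁ (x∈p∩q⁻ (N w) K a∈)
    a∈K = proj₂ (x∈p∩q⁻ (N w) K a∈)
    b∈N = proj₁ (x∈p∩q⁻ (N w) (S ─ K) b∈)
    b∈S = proj₁ (∈-─⁻ S K (proj₂ (x∈p∩q⁻ (N w) (S ─ K) b∈)))
    b∉K = proj₂ (∈-─⁻ S K (proj₂ (x∈p∩q⁻ (N w) (S ─ K) b∈)))
    S′ = S ∪ ⁅ w ⁆
    S⊆S′ : S ⊆ S′
    S⊆S′ = p⊆p∪q ⁅ w ⁆
    w∈S′ : w ∈ S′
    w∈S′ = q⊆p∪q S ⁅ w ⁆ (x∈⁅x⁆ w)
    la = proj₁ (spans (within a∈K))
    lb = proj₁ (spans b∈S)
    a⇝la = proj₂ (proj₂ (spans (within a∈K)))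
    b⇝lb = proj₂ (proj₂ (spans b∈S))
    la≢lb : la ≢ lb
    la≢lb eq = b∉K (absorbs (subst (Path S a) eq a⇝la ◅◅ path-sym b⇝lb) a∈K)
    L′ = filter (λ l → ¬? (l ≟ lb)) L
    L′<L : length L′ ℕ.< length L
    L′<L = filter-notAll _ L (lose (proj₁ (proj₂ (spans b∈S))) λ neq → neq refl)
    la∈L′ : la ∈ₗ L′
    la∈L′ = ∈-filter⁺ _ (proj₁ (proj₂ (spans (within a∈K)))) la≢lb
    w⇝la : Path S′ w la
    w⇝la = link w∈S′ (S⊆S′ (within a∈K)) (∈N⁻ a∈N) ◅◅ path-mono S⊆S′ a⇝la
    spans′ : Spans S′ L′
    spans′ {x} x∈ with x∈p∪q⁻ S ⁅ w ⁆ x∈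
    ... | inj₂ x∈w with refl ← x∈⁅y⁆⇒x≡y w x∈w = la , la∈L′ , w⇝la
    ... | inj₁ x∈S with spans x∈S
    ...   | l , l∈L , x⇝l with l ≟ lb
    ...     | no  l≢lb = l , ∈-filter⁺ _ l∈L l≢lb , path-mono S⊆S′ x⇝l
    ...     | yes refl = la , la∈L′ ,
      path-mono S⊆S′ (x⇝l ◅◅ path-sym b⇝lb) ◅◅ link (S⊆S′ b∈S) w∈S′ (adj-sym (∈N⁻ b∈N)) ◅◅ w⇝la
    shorten : ∀ {k} → length L′ ℕ.< k → ∃ λ k′ → k ≡ suc k′ × Rank S′ k′
    shorten (s≤s le) = _ , refl , L′ , le , spans′

  -- Independent neighbours and exchanges

  Apart : Fin n → Fin n → Set
  Apart x y = x ≢ y × adj G x y ≡ false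

  apart-sym : ∀ {x y} → Apart x y → Apart y x
  apart-sym {x} {y} (x≢y , na) = x≢y ∘ sym , trans (Graph.sym G y x) na

  apart-lookup : ∀ {L} → AllPairs Apart L → ∀ {i j} → i ≢ j → Apart (List.lookup L i) (List.lookup L j)
  apart-lookup (ps ∷ qs) {zero}  {zero}  i≢j = contradiction refl i≢j
  apart-lookup (ps ∷ qs) {zero}  {suc j} i≢j = All.lookup ps (∈-lookup j)
  apart-lookup (ps ∷ qs) {suc i} {zero}  i≢j = apart-sym (All.lookup ps (∈-lookup i))
  apart-lookup (ps ∷ qs) {suc i} {suc j} i≢j = apart-lookup qs (i≢j ∘ cong suc)

  -- The first `d` entries of a longer list would be the leaves of an induced claw with centre `v`.
  clawFree⇒few : ∀ {d v L} → ClawFree d G → All (_∈ N v) L → AllPairs Apart L → length L ℕ.≤ d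
  clawFree⇒few {d} {v} {L} free L⊆N apart with length L ℕ.≤? d
  ... | yes le = le
  ... | no  ¬le = contradiction (f , (λ {x} {y} → injective {x} {y}) , adjacency) free
    where
    le = <⇒≤ (≰⇒> ¬le)
    leaf : Fin d → Fin n
    leaf i = List.lookup L (inject≤ i le)
    leaf∈N : ∀ i → Adj G v (leaf i)
    leaf∈N i = ∈N⁻ (All.lookup L⊆N (∈-lookup (inject≤ i le)))
    leaves : ∀ {i j} → i ≢ j → Apart (leaf i) (leaf j)
    leaves i≢j = apart-lookup apart (i≢j ∘ inject≤-injective le le _ _)
    f : Fin (suc d) → Fin n
    f zero    = v
    f (suc i) = leaf i
    v≢leaf : ∀ i → v ≢ leaf i
    v≢leaf i eq = subst T (Graph.irrefl G v) (subst (Adj G v) (sym eq) (leaf∈N i))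
    injective : ∀ {x y} → f x ≡ f y → x ≡ y
    injective {zero}  {zero}  eq = refl
    injective {zero}  {suc j} eq = contradiction eq (v≢leaf j)
    injective {suc i} {zero}  eq = contradiction (sym eq) (v≢leaf i)
    injective {suc i} {suc j} eq with i ≟ j
    ... | yes i≡j = cong suc i≡j
    ... | no  i≢j = contradiction eq (proj₁ (leaves i≢j))
    adjacency : ∀ x y → adj G (f x) (f y) ≡ adj (claw d) x y
    adjacency zero    zero    = Graph.irrefl G v
    adjacency zero    (suc j) = Equivalence.to T-≡ (leaf∈N j)
    adjacency (suc i) zero    = Equivalence.to T-≡ (adj-sym (leaf∈N i))
    adjacency (suc i) (suc j) with i ≟ j
    ... | yes refl = Graph.irrefl G (leaf i)
    ... | no  i≢j  = proj₂ (leaves i≢j)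

  -- Greedy choice: a vertex of `S` is added unless it equals or is adjacent to one chosen before.
  maximalApart : ∀ S (us : List (Fin n)) → ∃ λ L → All (_∈ S) L × AllPairs Apart L ×
                 (∀ {u} → u ∈ₗ us → u ∈ S → ∃ λ l → l ∈ₗ L × (u ≡ l ⊎ Adj G u l))
  maximalApart S []       = [] , [] , [] , λ ()
  maximalApart S (u ∷ us) with maximalApart S us | u ∈? S
  ... | L , L⊆S , apart , dom | no u∉S =
    L , L⊆S , apart , λ { (here refl) u∈S → contradiction u∈S u∉S ; (there u∈) → dom u∈ }
  ... | L , L⊆S , apart , dom | yes u∈S with Any.any? (λ l → (u ≟ l) ⊎-dec T? (adj G u l)) L
  ...   | yes any = L , L⊆S , apart , λ { (here refl) _ → find any ; (there v∈) → dom v∈ }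
  ...   | no ¬any = u ∷ L , u∈S ∷ L⊆S , All.tabulate separate ∷ apart ,
    λ { (here refl) _ → u , here refl , inj₁ refl
      ; (there v∈) v∈S → let l , l∈ , r = dom v∈ v∈S in l , there l∈ , r }
    where
    separate : ∀ {l} → l ∈ₗ L → Apart u l
    separate {l} l∈ = (λ eq → ¬any (lose l∈ (inj₁ eq))) , nonadjacent
      where
      nonadjacent : adj G u l ≡ false
      nonadjacent with adj G u l in eq
      ... | false = refl
      ... | true  = contradiction (lose l∈ (inj₂ (Equivalence.from T-≡ eq))) ¬any

  exchange : Subset n → Fin n → Subset n
  exchange X v = (X ─ ⁅ v ⁆) ∪ N v

  ∈-remove : ∀ {S : Subset n} {u v} → u ∈ S → u ≢ v → u ∈ S ─ ⁅ v ⁆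
  ∈-remove = x∈p∧x≢y⇒x∈p-y

  exchange-cover : ∀ {X v} → VertexCover G X → VertexCover G (exchange X v)
  exchange-cover {X} {v} vc x y a with x ≟ v | y ≟ v
  ... | yes refl | _        = inj₂ (q⊆p∪q (X ─ ⁅ v ⁆) (N v) (∈N⁺ a))
  ... | no  _    | yes refl = inj₁ (q⊆p∪q (X ─ ⁅ v ⁆) (N v) (∈N⁺ (adj-sym a)))
  ... | no  x≢v  | no  y≢v  = Sum.map (λ x∈ → p⊆p∪q (N v) (∈-remove x∈ x≢v))
                                      (λ y∈ → p⊆p∪q (N v) (∈-remove y∈ y≢v)) (vc x y a)

  -- Every component of the exchanged set contains a neighbour of v, and hence a
  -- member of a maximal independent subset of N v.
  exchange-rank : ∀ {d X v} → ClawFree d G → Connected (G [ X ]) → v ∈ X → Rank (exchange X v) d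
  exchange-rank {d} {X} {v} free conn v∈X with maximalApart (N v) (allFin n)
  ... | L , L⊆N , apart , dom = L , clawFree⇒few free L⊆N apart , spans
    where
    S = exchange X v
    N⊆S : N v ⊆ S
    N⊆S = q⊆p∪q (X ─ ⁅ v ⁆) (N v)
    nearby : ∀ {x} → x ∈ N v → ∃ λ l → l ∈ₗ L × Path S x l
    nearby {x} x∈N with dom (∈-allFin x) x∈N
    ... | l , l∈L , inj₁ refl = l , l∈L , ε
    ... | l , l∈L , inj₂ a    = l , l∈L , link (N⊆S x∈N) (N⊆S (All.lookup L⊆N l∈L)) a
    walk : ∀ {x} → Path X x v → x ≢ v → ∃ λ y → y ∈ N v × Path S x y
    walk ε x≢v = contradiction refl x≢v
    walk {x} (_◅_ {j = y} (x∈X , y∈X , a) r) x≢v with y ≟ v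
    ... | yes refl = x , ∈N⁺ (adj-sym a) , ε
    ... | no  y≢v  = let z , z∈N , y⇝z = walk r y≢v in
      z , z∈N , (p⊆p∪q (N v) (∈-remove x∈X x≢v) , p⊆p∪q (N v) (∈-remove y∈X y≢v) , a) ◅ y⇝z
    spans : Spans S L
    spans {x} x∈ with x∈p∪q⁻ (X ─ ⁅ v ⁆) (N v) x∈
    ... | inj₂ x∈N = nearby x∈N
    ... | inj₁ x∈X─v =
      let x∈X , x∉v       = ∈-─⁻ X ⁅ v ⁆ x∈X─v
          y , y∈N , x⇝y   = walk (connected⇒paths conn x∈X v∈X) (x∉⁅y⁆⇒x≢y x∉v)
          l , l∈L , y⇝l   = nearby y∈N
      in l , l∈L , x⇝y ◅◅ y⇝l

  module _ (connected : Connected G) where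

    -- A vertex of `T` outside `S` has a neighbour, because `G` is connected, and that neighbour
    -- lies in `S`, because `S` covers the edge between them.
    cvc-mono : ∀ {S T} → S ⊆ T → ConnectedVertexCover G S → ConnectedVertexCover G T
    cvc-mono {S} {T} S⊆T (vc , conn) = (λ u v a → Sum.map S⊆T S⊆T (vc u v a)) , paths⇒connected paths
      where
      -- The second vertex `y` provides an edge at `x`. In a graph with a single vertex `S` may be
      -- empty, and there would be nothing to attach `x` to.
      attach : ∀ {x y} → x ∈ T → x ≢ y → ∃ λ z → z ∈ S × Path T x z
      attach {x} {y} x∈T x≢y with x ∈? S
      ... | yes x∈S = x , x∈S , ε
      ... | no  x∉S with connected x y
      ...   | ε = contradiction refl x≢y
      ...   | _◅_ {j = z} a _ with vc x z a
      ...     | inj₁ x∈S = contradiction x∈S x∉S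
      ...     | inj₂ z∈S = z , z∈S , link x∈T (S⊆T z∈S) a
      paths : ∀ {x y} → x ∈ T → y ∈ T → Path T x y
      paths {x} {y} x∈ y∈ with x ≟ y
      ... | yes refl = ε
      ... | no  x≢y  =
        let x′ , x′∈ , x⇝x′ = attach x∈ x≢y
            y′ , y′∈ , y⇝y′ = attach y∈ (x≢y ∘ sym)
        in x⇝x′ ◅◅ path-mono S⊆T (connected⇒paths conn x′∈ y′∈) ◅◅ path-sym y⇝y′

    ⊤-cvc : ConnectedVertexCover G ⊤
    ⊤-cvc = (λ _ _ _ → inj₁ ∈⊤) ,
            paths⇒connected λ {x} {y} _ _ → Star.map (λ a → ∈⊤ , ∈⊤ , a) (connected x y)

    ⊤-rank : Rank ⊤ 1
    ⊤-rank = L , few , λ {x} _ → spans x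
      where
      L : List (Fin n)
      -- Taking at most one vertex also covers the graph without vertices, whose list stays empty.
      L = List.take 1 (allFin n)
      few : length L ≤ 1
      few = ≤-trans (≤-reflexive (length-take 1 (allFin n))) (ℕ.m⊓n≤m 1 _)
      spans : ∀ x → ∃ λ l → l ∈ₗ L × Path ⊤ x l
      spans x with allFin n | ∈-allFin x
      ... | l ∷ _ | _ = l , here refl , Star.map (λ a → ∈⊤ , ∈⊤ , a) (connected x l)

    Irredundant : Subset n → Set
    Irredundant S = ∀ {u} → u ∈ S → ¬ ConnectedVertexCover G (S ─ ⁅ u ⁆)

    -- A proper subset misses some `x` and so lies in `S ─ ⁅ x ⁆`; by monotonicity it suffices to
    -- test deletions of single vertices.
    irredundant⇒minimal : ∀ {S} → ConnectedVertexCover G S → Irredundant S →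
                          MinimalConnectedVertexCover G S
    irredundant⇒minimal cvc irr = cvc , λ T (T⊆S , x , x∈S , x∉T) cvcT → irr x∈S
      (cvc-mono (λ {y} y∈T → ∈-remove (T⊆S y∈T) λ eq → x∉T (subst (_∈ T) eq y∈T)) cvcT)

    shrink-cases : ∀ S u → (shrink S u ≡ S ─ ⁅ u ⁆ × ConnectedVertexCover G (S ─ ⁅ u ⁆))
                         ⊎ (shrink S u ≡ S × ¬ ConnectedVertexCover G (S ─ ⁅ u ⁆))
    shrink-cases S u with isCVC (S ─ ⁅ u ⁆) | isCVC-reflects (S ─ ⁅ u ⁆)
    ... | true  | ofʸ cvc  = inj₁ (refl , cvc)
    ... | false | ofⁿ ¬cvc = inj₂ (refl , ¬cvc)

    shrink-⊆ : ∀ S u → shrink S u ⊆ S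
    shrink-⊆ S u with shrink-cases S u
    ... | inj₁ (eq , _) = ⊆-trans (⊆-reflexive eq) (p─q⊆p S ⁅ u ⁆)
    ... | inj₂ (eq , _) = ⊆-reflexive eq

    shrinks-⊆ : ∀ S us → foldl shrink S us ⊆ S
    shrinks-⊆ S []       = id
    shrinks-⊆ S (u ∷ us) = ⊆-trans (shrinks-⊆ (shrink S u) us) (shrink-⊆ S u)

    shrinks-cvc : ∀ {S} us → ConnectedVertexCover G S → ConnectedVertexCover G (foldl shrink S us)
    shrinks-cvc         []       cvc = cvc
    shrinks-cvc {S = S} (u ∷ us) cvc with shrink-cases S u
    ... | inj₁ (eq , cvc′) = shrinks-cvc us (subst (ConnectedVertexCover G) (sym eq) cvc′)
    ... | inj₂ (eq , _)    = shrinks-cvc us (subst (ConnectedVertexCover G) (sym eq) cvc)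

    -- Testing each vertex once is enough: if deleting `u` failed when `u` was tested, it also fails
    -- for the smaller final set, again by monotonicity; and a deleted vertex never returns.
    shrinks-irredundant : ∀ {S} us {u} → u ∈ₗ us → u ∈ foldl shrink S us →
                          ¬ ConnectedVertexCover G (foldl shrink S us ─ ⁅ u ⁆)
    shrinks-irredundant         (v ∷ us) (there u∈) = shrinks-irredundant us u∈
    shrinks-irredundant {S = S} (u ∷ us) (here refl) u∈R with shrink-cases S u
    ... | inj₁ (eq , _) = contradiction (x∈⁅x⁆ u)
      (proj₂ (∈-─⁻ S ⁅ u ⁆ (⊆-reflexive eq (shrinks-⊆ (shrink S u) us u∈R))))
    ... | inj₂ (eq , ¬cvc) = ¬cvc ∘ cvc-mono λ x∈ →
      let x∈R , x∉u = ∈-─⁻ (foldl shrink (shrink S u) us) ⁅ u ⁆ x∈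
      in x∈p∧x∉q⇒x∈p─q (shrink-⊆ S u (shrinks-⊆ (shrink S u) us x∈R)) x∉u

    minimise-⊆ : ∀ S → minimise S ⊆ S
    minimise-⊆ S = ⊆-trans (shrinks-⊆ (S ∪ S) (allFin n)) (⊆-∪-elim id id)

    minimise-minimal : ∀ {S} → ConnectedVertexCover G S → MinimalConnectedVertexCover G (minimise S)
    minimise-minimal {S} cvc = irredundant⇒minimal
      (shrinks-cvc (allFin n) (cvc-mono (p⊆p∪q S) cvc))
      (λ {u} → shrinks-irredundant (allFin n) (∈-allFin u))

  module Branch (S : Subset n) where

    private K = component S

    Bridge : Fin n → Set
    Bridge u = Nonempty (N u ∩ K) × Nonempty (N u ∩ (S ─ K))

    extend-spec : ∀ W u → (extend S K W u ≡ W × ¬ Bridge u) ⊎ (extend S K W u ≡ (S ∪ ⁅ u ⁆) ∷ W × Bridge u)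
    extend-spec W u with some (N u ∩ K) | some-reflects (N u ∩ K)
    ... | false | ofⁿ ¬p = inj₁ (refl , ¬p ∘ proj₁)
    ... | true  | ofʸ p with some (N u ∩ (S ─ K)) | some-reflects (N u ∩ (S ─ K))
    ...   | false | ofⁿ ¬q = inj₁ (refl , ¬q ∘ proj₂)
    ...   | true  | ofʸ q  = inj₂ (refl , p , q)

    open Collect Bridge (λ u → S ∪ ⁅ u ⁆) (extend S K) extend-spec public

  module Successors (X : Subset n) where

    successor-spec : ∀ W u → (successor X W u ≡ W × u ∉ X) ⊎ (successor X W u ≡ exchange X u ∷ W × u ∈ X)
    successor-spec W u with some (⁅ u ⁆ ∩ X) | some-reflects (⁅ u ⁆ ∩ X)
    ... | false | ofⁿ ¬p = inj₁ (refl , λ u∈ → ¬p (u , x∈p∩q⁺ (x∈⁅x⁆ u , u∈)))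
    ... | true  | ofʸ (x , x∈) with x∈p∩q⁻ ⁅ u ⁆ X x∈
    ...   | x∈u , x∈X with refl ← x∈⁅y⁆⇒x≡y u x∈u = inj₂ (refl , x∈X)

    open Collect (_∈ X) (exchange X) (successor X) successor-spec public

-- The search

record Visited {n} (t : Tree) (Y : Subset n) : Set where
  constructor visited
  field found : T (isTrue (search Y t))

open Visited

search-nil : ∀ {m} (Y : Subset m) → search Y nil ≡ nil
search-nil []          = refl
search-nil (true  ∷ Y) = search-nil Y
search-nil (false ∷ Y) = search-nil Y

search-insert : ∀ {m} (Y : Subset m) t → search Y (insert Y t) ≡ nil ∙ nil
search-insert []          t = refl
search-insert (true  ∷ Y) t = search-insert Y (tail t)
search-insert (false ∷ Y) t = search-insert Y (head t)

search-insert-≢ : ∀ {m} (Z Y : Subset m) t → Z ≢ Y → search Z (insert Y t) ≡ search Z t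
search-insert-≢ []          []          t neq = contradiction refl neq
search-insert-≢ (true  ∷ Z) (true  ∷ Y) t neq = search-insert-≢ Z Y (tail t) (neq ∘ cong (true ∷_))
search-insert-≢ (false ∷ Z) (false ∷ Y) t neq = search-insert-≢ Z Y (head t) (neq ∘ cong (false ∷_))
search-insert-≢ (true  ∷ Z) (false ∷ Y) t neq = refl
search-insert-≢ (false ∷ Z) (true  ∷ Y) t neq = refl

_≟ˢ_ : ∀ {m} (Z Y : Subset m) → Dec (Z ≡ Y)
_≟ˢ_ = ≡-dec Bool._≟_

visited-insert⁺ : ∀ {m} {Z Y : Subset m} {t} → Z ≡ Y ⊎ Visited t Z → Visited (insert Y t) Z
visited-insert⁺ {Z = Z} {Y} {t} v with Z ≟ˢ Y
... | yes refl = visited (subst (T ∘ isTrue) (sym (search-insert Z t)) _)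
... | no  neq  = [ (λ eq → contradiction eq neq)
                 , (λ v → visited (subst (T ∘ isTrue) (sym (search-insert-≢ Z Y t neq)) (found v))) ]′ v

visited-insert⁻ : ∀ {m} {Z Y : Subset m} {t} → Visited (insert Y t) Z → Z ≡ Y ⊎ Visited t Z
visited-insert⁻ {Z = Z} {Y} {t} v with Z ≟ˢ Y
... | yes eq  = inj₁ eq
... | no  neq = inj₂ (visited (subst (T ∘ isTrue) (search-insert-≢ Z Y t neq) (found v)))

unique-length : ∀ {m} {Cs : List (Subset m)} → Unique Cs → length Cs ≤ 2 ^ m
unique-length {m} {Cs} unique =
  injective⇒≤ {f = λ i → code (List.lookup Cs i)} λ {i} {j} eq →
    lookup-injective unique i j (code-injective _ _ eq)
  where
  digit : Bool → Fin 2
  digit false = 0F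
  digit true  = 1F
  digit-injective : ∀ b c → digit b ≡ digit c → b ≡ c
  digit-injective false false _ = refl
  digit-injective true  true  _ = refl
  code : ∀ {m} → Subset m → Fin (2 ^ m)
  code []      = 0F
  code (b ∷ S) = Fin.combine (digit b) (code S)
  code-injective : ∀ {m} (S T : Subset m) → code S ≡ code T → S ≡ T
  code-injective []      []      _  = refl
  code-injective (b ∷ S) (c ∷ T) eq with combine-injective (digit b) (code S) (digit c) (code T) eq
  ... | p , q = cong₂ _∷_ (digit-injective b c p) (code-injective S T q)
  lookup-injective : ∀ {Cs : List (Subset m)} → Unique Cs → ∀ i j →
                     List.lookup Cs i ≡ List.lookup Cs j → i ≡ j
  lookup-injective (p ∷ u) zero    zero    eq = refl
  lookup-injective (p ∷ u) zero    (suc j) eq = contradiction eq (All.lookup p (∈-lookup j))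
  lookup-injective (p ∷ u) (suc i) zero    eq = contradiction (sym eq) (All.lookup p (∈-lookup i))
  lookup-injective (p ∷ u) (suc i) (suc j) eq = cong suc (lookup-injective u i j eq)

-- Bounds the number of sets that branching creates out of a set of rank k.
spread : ℕ → ℕ → ℕ
spread n zero    = 1
spread n (suc k) = 1 + n * spread n k

1≤spread : ∀ n k → 1 ≤ spread n k
1≤spread n zero    = ≤-refl
1≤spread n (suc k) = s≤s z≤n

module Search {n} (G : Graph (Fin n)) (connected : Connected G) where

  open Algorithm G
  open Graphs G

  -- The index is a potential that bounds the number of sets still to be processed: a waiting set of
  -- rank `k` is charged for its whole tree of descendants. Slack is allowed everywhere.
  data Pending : List (Subset n) → ℕ → Set where
    []   : ∀ {φ} → Pending [] φ
    push : ∀ {S W k φ ψ} → VertexCover G S → Rank S k → spread n k + φ ≤ ψ →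
           Pending W φ → Pending (S ∷ W) ψ

  pending-weaken : ∀ {W φ ψ} → φ ≤ ψ → Pending W φ → Pending W ψ
  pending-weaken le []              = []
  pending-weaken le (push vc r b p) = push vc r (≤-trans b le) p

  pending-++ : ∀ {new W k φ} m → All (λ S → VertexCover G S × Rank S k) new → length new ≤ m →
               Pending W φ → Pending (new ++ W) (m * spread n k + φ)
  pending-++ {k = k} {φ} m [] le p = pending-weaken (m≤n+m φ (m * spread n k)) p
  pending-++ {k = k} {φ} (suc m) ((vc , r) ∷ all) (s≤s le) p =
    push vc r (≤-reflexive (sym (+-assoc (spread n k) (m * spread n k) φ))) (pending-++ m all le p)

  -- `Ps` are the covers already output, `Xs` those found but still waiting, and the trie holds
  -- exactly the union of both.
  record Invariant (Ps Xs : List (Subset n)) (t : Tree) : Set where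
    field
      uniquePs : Unique Ps
      uniqueXs : Unique Xs
      disjoint : ∀ {Y} → Y ∈ₗ Xs → Y ∉ₗ Ps
      sound    : ∀ {Y} → Visited t Y → Y ∈ₗ Xs ⊎ Y ∈ₗ Ps
      complete : ∀ {Y} → Y ∈ₗ Xs ⊎ Y ∈ₗ Ps → Visited t Y
      minimal  : ∀ {Y} → Visited t Y → MinimalConnectedVertexCover G Y

  Reached : Tree → Subset n → Set
  Reached t U = ∃ λ Y → Visited t Y × Y ⊆ U

  -- For a fixed target region `U` this property survives every step. When the work list has run
  -- empty, only the first alternative is left, and a cover inside `U` has been found.
  Hit : List (Subset n) → Tree → Subset n → Set
  Hit W t U = Reached t U ⊎ ∃ λ S → S ∈ₗ W × S ⊆ U

  record Advance (Ps W : List (Subset n)) (t : Tree) (W′ X′ : List (Subset n)) (t′ : Tree) : Set where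
    field
      invariant : Invariant Ps X′ t′
      mono      : ∀ {Y : Subset n} → Visited t Y → Visited t′ Y
      hits      : ∀ {U} → ConnectedVertexCover G U → Hit W t U → Hit W′ t′ U

  advance-trans : ∀ {Ps W t W′ X′ t′ W″ X″ t″} → Advance Ps W t W′ X′ t′ →
                  Advance Ps W′ t′ W″ X″ t″ → Advance Ps W t W″ X″ t″
  advance-trans a b = record
    { invariant = Advance.invariant b
    ; mono      = λ v → Advance.mono b (Advance.mono a v)
    ; hits      = λ cvc h → Advance.hits b cvc (Advance.hits a cvc h) }

  record Processed (Ps W : List (Subset n)) (t : Tree) (φ : ℕ) (st : State) : Set where
    field
      {W′ X′} : List (Subset n)
      {t′}    : Tree
      result  : st ≡ (W′ , X′ , t′)
      advance : Advance Ps W t W′ X′ t′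
      left    : ℕ
      fewer   : left < φ
      pending : Pending W′ left

  hits-pop : ∀ {S W t t′ U} → (∀ {Y} → Visited t Y → Visited t′ Y) →
             (S ⊆ U → Reached t′ U) → Hit (S ∷ W) t U → Hit W t′ U
  hits-pop mono r (inj₁ (Y , v , Y⊆U))           = inj₁ (Y , mono v , Y⊆U)
  hits-pop mono r (inj₂ (S , here refl , S⊆U))   = inj₁ (r S⊆U)
  hits-pop mono r (inj₂ (S , there S∈W , S⊆U))   = inj₂ (S , S∈W , S⊆U)

  insert-invariant : ∀ {Ps Xs t Y} → Invariant Ps Xs t → MinimalConnectedVertexCover G Y →
                     ¬ Visited t Y → Invariant Ps (Y ∷ Xs) (insert Y t)
  insert-invariant {Ps} {Xs} {t} {Y} inv min new = record
    { uniquePs = uniquePs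
    ; uniqueXs = All.tabulate (λ { Z∈ refl → new (complete (inj₁ Z∈)) }) ∷ uniqueXs
    ; disjoint = λ { (here refl) Y∈ → new (complete (inj₂ Y∈)) ; (there Z∈) → disjoint Z∈ }
    ; sound    = λ v → [ inj₁ ∘ here , Sum.map₁ there ∘ sound ]′ (visited-insert⁻ v)
    ; complete = λ { (inj₁ (here eq))  → visited-insert⁺ (inj₁ eq)
                   ; (inj₁ (there Z∈)) → visited-insert⁺ (inj₂ (complete (inj₁ Z∈)))
                   ; (inj₂ Z∈)         → visited-insert⁺ (inj₂ (complete (inj₂ Z∈))) }
    ; minimal  = λ v → [ (λ { refl → min }) , minimal ]′ (visited-insert⁻ v)
    }
    where open Invariant inv

  -- Each outcome spends at least one unit of potential: a connected `S` gives up its whole share,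
  -- and branching replaces `spread n (suc k′)` by at most `n` shares `spread n k′`, which is one
  -- less by definition.
  process-step : ∀ {Ps S W Xs t k φ} → Invariant Ps Xs t → VertexCover G S → Rank S k → Pending W φ →
                 Processed Ps (S ∷ W) t (spread n k + φ) (process S (W , Xs , t))
  process-step {Ps} {S} {W} {Xs} {t} {k} {φ} inv vc rank pending with isCVC S | isCVC-reflects S
  ... | true | ofʸ cvc with isTrue (search (minimise S) t) in eq
  ...   | true  = record
    { result = refl
    ; advance = record { invariant = inv ; mono = λ v → v ; hits = λ _ → hits-pop (λ v → v) λ S⊆U →
                           minimise S , visited (subst T (sym eq) _) , ⊆-trans (minimise-⊆ connected S) S⊆U }
    ; left = φ ; fewer = ℕ.+-monoˡ-≤ φ (1≤spread n k) ; pending = pending }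
  ...   | false = record
    { result = refl
    ; advance = record
      { invariant = insert-invariant inv (minimise-minimal connected cvc) (λ v → subst T eq (found v))
      ; mono = λ v → visited-insert⁺ (inj₂ v)
      ; hits = λ _ → hits-pop (λ v → visited-insert⁺ (inj₂ v)) λ S⊆U →
          Y , visited-insert⁺ (inj₁ refl) , ⊆-trans (minimise-⊆ connected S) S⊆U }
    ; left = φ ; fewer = ℕ.+-monoˡ-≤ φ (1≤spread n k) ; pending = pending }
    where Y = minimise S
  process-step {Ps} {S} {W} {Xs} {t} {k} {φ} inv vc rank pending | false | ofⁿ ¬cvc = record
    { result = refl
    ; advance = record { invariant = inv ; mono = λ v → v ; hits = hits′ }
    ; left = proj₁ pending′ ; fewer = proj₁ (proj₂ pending′) ; pending = proj₂ (proj₂ pending′) }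
    where
    comp = component-isComponent S
    open Branch S
    open Collected (collect (allFin n) W)
    S⊆ : ∀ {w} → S ⊆ S ∪ ⁅ w ⁆
    S⊆ = p⊆p∪q _
    cover′ : ∀ w → VertexCover G (S ∪ ⁅ w ⁆)
    cover′ w u v a = Sum.map S⊆ S⊆ (vc u v a)
    pending′ : ∃ λ ψ → ψ < spread n k + φ × Pending (branch S W) ψ
    pending′ with new | split | few | only
    -- Without a new set there is no bridge to make `k` a successor, and the share of `S` is simply
    -- released.
    ... | [] | sp | _ | _ = φ , ℕ.+-monoˡ-≤ φ (1≤spread n k) , subst (λ V → Pending V φ) (sym sp) pending
    -- The first bridge reveals the predecessor `k′` of `k`; the other new sets then have rank `k′`
    -- as well.
    ... | T ∷ Ts | sp | le | all@((w , (p , q) , _) ∷ _) with rank-drops comp p q rank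
    ...   | k′ , refl , _ = n * spread n k′ + φ , ≤-refl ,
      subst (λ V → Pending V (n * spread n k′ + φ)) (sym sp)
        (pending-++ n (All.map ranked all)
          (≤-trans le (≤-reflexive (length-tabulate {n = n} id))) pending)
      where
      ranked : ∀ {T} → (∃ λ u → Bridge u × T ≡ S ∪ ⁅ u ⁆) → VertexCover G T × Rank T k′
      ranked (u , (p , q) , refl) with rank-drops comp p q rank
      ... | _ , refl , r = cover′ u , r
    hits′ : ∀ {U} → ConnectedVertexCover G U → Hit (S ∷ W) t U → Hit (branch S W) t U
    hits′ cvcU (inj₁ r) = inj₁ r
    hits′ cvcU (inj₂ (T , there T∈W , T⊆U)) =
      inj₂ (T , subst (T ∈ₗ_) (sym split) (∈-++⁺ʳ new T∈W) , T⊆U)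
    hits′ {U} cvcU (inj₂ (_ , here refl , S⊆U)) with nonempty? (S ─ component S)
    ... | no empty = contradiction (vc , component-exhausts empty) ¬cvc
    ... | yes b with bridge vc comp S⊆U (proj₂ cvcU) b
    ...   | w , w∈U , p , q = inj₂ (S ∪ ⁅ w ⁆ ,
      subst (S ∪ ⁅ w ⁆ ∈ₗ_) (sym split) (∈-++⁺ˡ (complete (∈-allFin w) (p , q))) ,
      ⊆-∪-elim S⊆U (⁅⁆⊆ w∈U))

  -- The search has no target, so the moves out of an output cover `X` must serve all `Z` at once: a
  -- cover found inside this region avoids `v` and has no vertices beyond those of `X` and `Z`.
  Closed : List (Subset n) → Tree → Set
  Closed Ps t = ∀ {X Z v} → X ∈ₗ Ps → MinimalConnectedVertexCover G Z → v ∈ X → v ∉ Z →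
                Reached t ((X ∪ Z) ─ ⁅ v ⁆)

  -- Each step of the search replaces Y by a cover with fewer vertices outside Z.
  closed-complete : ∀ {Ps t} → Invariant Ps [] t → Closed Ps t → ∃ (Visited t) →
                    ∀ {Z} → MinimalConnectedVertexCover G Z → Z ∈ₗ Ps
  closed-complete {Ps} {t} inv closed (Y₀ , visited₀) {Z} minZ =
    go _ ≤-refl (inPs visited₀)
    where
    open Invariant inv
    inPs : ∀ {Y} → Visited t Y → Y ∈ₗ Ps
    inPs v = [ (λ ()) , id ]′ (sound v)
    go : ∀ m {Y} → ∣ Y ─ Z ∣ ≤ m → Y ∈ₗ Ps → Z ∈ₗ Ps
    go m {Y} le Y∈ with nonempty? (Y ─ Z)
    go m {Y} le Y∈ | no empty with nonempty? (Z ─ Y)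
    ... | no  empty′   = subst (_∈ₗ Ps) (⊆-antisym (empty-─⇒⊆ empty) (empty-─⇒⊆ empty′)) Y∈
    ... | yes (x , x∈) =
      contradiction (proj₁ (minimal (complete (inj₂ Y∈)))) (proj₂ minZ Y (empty-─⇒⊆ empty , x , ∈-─⁻ Z Y x∈))
    go zero {Y} le Y∈ | yes (v , v∈) = contradiction (≤-trans (nonempty⇒1≤ v∈) le) λ ()
      where
      nonempty⇒1≤ : ∀ {x} {S : Subset n} → x ∈ S → 1 ≤ ∣ S ∣
      nonempty⇒1≤ {x} x∈ = ≤-trans (≤-reflexive (sym (∣⁅x⁆∣≡1 x))) (p⊆q⇒∣p∣≤∣q∣ (⁅⁆⊆ x∈))
    go (suc m) {Y} le Y∈ | yes (v , v∈) with ∈-─⁻ Y Z v∈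
    ... | v∈Y , v∉Z with closed Y∈ minZ v∈Y v∉Z
    ...   | Y′ , visited′ , Y′⊆ = go m
      (ℕ.≤-pred (≤-trans (p⊂q⇒∣p∣<∣q∣ (closer , v , v∈ , λ v∈′ → v∉Y′ (p─q⊆p Y′ Z v∈′))) le))
      (inPs visited′)
      where
      v∉Y′ : v ∉ Y′
      v∉Y′ v∈Y′ = proj₂ (∈-─⁻ (Y ∪ Z) ⁅ v ⁆ (Y′⊆ v∈Y′)) (x∈⁅x⁆ v)
      closer : Y′ ─ Z ⊆ Y ─ Z
      closer {x} x∈ =
        let x∈Y′ , x∉Z = ∈-─⁻ Y′ Z x∈
        in x∈p∧x∉q⇒x∈p─q
             ([ id , (λ x∈Z → contradiction x∈Z x∉Z) ]′ (x∈p∪q⁻ Y Z (proj₁ (∈-─⁻ (Y ∪ Z) ⁅ v ⁆ (Y′⊆ x∈Y′)))))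
             x∉Z

  pop-invariant : ∀ {Ps X Xs t} → Invariant Ps (X ∷ Xs) t → Invariant (Ps ++ X ∷ []) Xs t
  pop-invariant {Ps} {X} {Xs} inv with Invariant.uniqueXs inv
  ... | X∉Xs ∷ unique = record
    { uniquePs = Unique.++⁺ uniquePs ([] ∷ []) λ { (Y∈ , here refl) → disjoint (here refl) Y∈ }
    ; uniqueXs = unique
    ; disjoint = λ Y∈Xs Y∈ → [ disjoint (there Y∈Xs) , (λ { (here refl) → All.lookup X∉Xs Y∈Xs refl }) ]′
                               (∈-++⁻ Ps Y∈)
    ; sound    = λ v → [ (λ { (here refl) → inj₂ (∈-++⁺ʳ Ps (here refl)) ; (there Y∈) → inj₁ Y∈ })
                       , inj₂ ∘ ∈-++⁺ˡ ]′ (sound v)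
    ; complete = [ complete ∘ inj₁ ∘ there
                 , [ complete ∘ inj₂ , (λ { (here refl) → complete (inj₁ (here refl)) }) ]′ ∘ ∈-++⁻ Ps ]′
    ; minimal  = minimal
    }
    where open Invariant inv

  module Exchange {d} (clawFree : ClawFree d G) {X} (minX : MinimalConnectedVertexCover G X) where

    open Successors X
    open Collected (collect (allFin n) [])

    exchanges-pending : Pending (successors X) (n * spread n d + 0)
    exchanges-pending = subst (λ W → Pending W (n * spread n d + 0)) (sym split)
      (pending-++ n
        (All.map (λ { (u , u∈X , refl) → exchange-cover (proj₁ (proj₁ minX)) ,
                                         exchange-rank clawFree (proj₂ (proj₁ minX)) u∈X }) only)
        (≤-trans few (≤-reflexive (length-tabulate {n = n} id))) [])

    exchange-closed : ∀ {Ps t X′ t′} → Closed Ps t → Advance (Ps ++ X ∷ []) (successors X) t [] X′ t′ →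
                      Closed (Ps ++ X ∷ []) t′
    exchange-closed {Ps} closed a {Z = Z} {v} Y∈ minZ v∈ v∉Z with ∈-++⁻ Ps Y∈
    ... | inj₁ Y∈Ps = let Y , vis , Y⊆ = closed Y∈Ps minZ v∈ v∉Z in Y , Advance.mono a vis , Y⊆
    ... | inj₂ (here refl) with Advance.hits a {U} cvcU (inj₂ (exchange X v , exchange∈ , exchange⊆))
      where
      U = (X ∪ Z) ─ ⁅ v ⁆
      inU : ∀ {x} → x ∈ X ⊎ x ∈ Z → x ≢ v → x ∈ U
      inU x∈ x≢v = ∈-remove (x∈p∪q⁺ x∈) x≢v
      -- Since `v ∉ Z`, the region `U` contains `Z`.
      cvcU : ConnectedVertexCover G U
      cvcU = cvc-mono connected (λ {x} x∈Z → inU (inj₂ x∈Z) λ { refl → v∉Z x∈Z }) (proj₁ minZ)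
      exchange∈ : exchange X v ∈ₗ successors X
      exchange∈ = subst (exchange X v ∈ₗ_) (sym split)
        (∈-++⁺ˡ (Collected.complete (collect (allFin n) []) (∈-allFin v) v∈))
      exchange⊆ : exchange X v ⊆ U
      exchange⊆ = ⊆-∪-elim
        (λ x∈ → let x∈X , x∉v = ∈-─⁻ X ⁅ v ⁆ x∈ in inU (inj₁ x∈X) (x∉⁅y⁆⇒x≢y x∉v))
        -- As `v ∉ Z`, covering the edges at `v` forces every neighbour of `v` into `Z`.
        (λ {x} x∈N → inU (inj₂ ([ (λ v∈Z → contradiction v∈Z v∉Z) , id ]′ (proj₁ (proj₁ minZ) v x (∈N⁻ x∈N))))
                         λ { refl → subst T (Graph.irrefl G v) (∈N⁻ x∈N) })
    ...   | inj₁ reached = reached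

-- Running time and delay

-- The encoding of a state is itself an environment list, so the computed value is moved from the
-- stack to variable 0 and serves the next term at once.
step : ∀ {k} → Term k → Command 3
step t = compile t ⨟ 0F := hd stk ⨟ 1F := tl stk

module Enumerator (init : Term 0) (proc exp : Term 3) where

  work main body : Command 3
  work = while hd env loop step proc
  main = while hd (tl env) loop (output (hd (hd (tl env))) ⨟ step exp ⨟ work)
  -- The grouping separates a prefix without outputs from the main loop. The rows are saved first,
  -- and `nil` is the empty environment in which `init` is evaluated.
  body = (2F := env ⨟ 0F := nil ⨟ step init ⨟ work) ⨟ main

step-run : ∀ {n k} (V : Vec Tree n) {ρ : Vec Tree k} {t v} → _⊢_⇓_ V ρ t v →
           Run (step t) (store V ρ nil) (bound n (step t)) (v ∷ nil ∷ ⟨ V ⟩ ∷ [])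
step-run V d = compile-run V d nil ⨾ run-assign ⨾ run-assign

outputs-ticks : ∀ m τ → outputs (ticks m ++ τ) ≡ outputs τ
outputs-ticks zero    τ = refl
outputs-ticks (suc m) τ = outputs-ticks m τ

gaps-ticks : ∀ k m τ → gapsFrom k (ticks m ++ τ) ≡ gapsFrom (m + k) τ
gaps-ticks k zero    τ = refl
gaps-ticks k (suc m) τ = trans (gaps-ticks (suc k) m τ) (cong (λ j → gapsFrom j τ) (ℕ.+-suc m k))

module _ {n} (G : Graph (Fin n)) where

  open Algorithm G
  open Correctness G

  encode-row : ∀ u {m} (g : Fin m → Fin n) →
    encodeList (λ v → encodeBool (adj G u v)) (List.tabulate g) ≡ encodeSubset (tabulate (adj G u ∘ g))
  encode-row u {zero}  g = refl
  encode-row u {suc m} g = cong (encodeBool (adj G u (g zero)) ∙_) (encode-row u (g ∘ suc))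

  encodeGraph-rows : encodeGraph G ≡ ⟨ tabulate row ⟩
  encodeGraph-rows = rows-of id
    where
    rows-of : ∀ {m} (g : Fin m → Fin n) →
      encodeList (λ u → encodeList (λ v → encodeBool (adj G u v)) (allFin n)) (List.tabulate g)
        ≡ ⟨ tabulate (row ∘ g) ⟩
    rows-of {zero}  g = refl
    rows-of {suc m} g = cong₂ _∙_ (encode-row (g zero) id) (rows-of (g ∘ suc))

-- 40 is the sum of all constants collected by the power rules in `delay≤`. The exponent `p` occurs
-- twice because the processing loop runs both at the start and after each expansion.
delayExponent : ℕ → ℕ → ℕ → ℕ
delayExponent i p e = 40 + (i + e + (p + p))

module Delay (n : ℕ) where

  N : ℕ
  N = n ⊔ 2

  2≤N : 2 ≤ N
  2≤N = m≤n⊔m n 2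

  n≤N : n ≤ N
  n≤N = m≤m⊔n n 2

  -- The added 1 makes the induction close: `2 + n * s` is at most `N + N * s`, which is
  -- `N * (s + 1)`.
  spread+1≤ : ∀ k → spread n k + 1 ≤ 2 * N ^ k
  spread+1≤ zero    = ≤-refl
  spread+1≤ (suc k) = begin
    1 + n * spread n k + 1     ≡⟨ +-comm (1 + n * spread n k) 1 ⟩
    2 + n * spread n k         ≤⟨ +-mono-≤ 2≤N (ℕ.*-monoˡ-≤ (spread n k) n≤N) ⟩
    N + N * spread n k         ≡⟨ expanded N (spread n k) ⟩
    N * (spread n k + 1)       ≤⟨ ℕ.*-monoʳ-≤ N (spread+1≤ k) ⟩
    N * (2 * N ^ k)            ≡⟨ commuted N (N ^ k) ⟩
    2 * (N * N ^ k)            ∎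
    where
    open ℕ.≤-Reasoning
    expanded : ∀ a b → a + a * b ≡ a * (b + 1)
    expanded = solve-∀
    commuted : ∀ a b → a * (2 * b) ≡ 2 * (a * b)
    commuted = solve-∀

  open Powers 2≤N

  spread≤^ : ∀ k → spread n k ≤^ 1 + k
  spread≤^ k = power (≤-trans (m≤m+n _ 1) (≤-trans (spread+1≤ k) (ℕ.*-monoˡ-≤ (N ^ k) 2≤N)))

  delay≤ : ∀ {b₁ b₂ b₃ i p e} d → b₁ ≤^ i → b₂ ≤^ p → b₃ ≤^ e →
    (2 + (2 + b₁) + (spread n 1 * (3 + b₂) + 3)) + (b₃ + ((n * spread n d + 0) * (3 + b₂) + 3)) + 9
      ≤ N ^ (d + delayExponent i p e)
  delay≤ {i = i} {p} {e} d b₁≤ b₂≤ b₃≤ = ≤-trans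
    (_≤^_.≤-power (+-≤^
      (+-≤^
        (+-≤^ (+-≤^ (≤^-self 2) (+-≤^ (≤^-self 2) b₁≤))
              (+-≤^ (*-≤^ (spread≤^ 1) iteration≤) (≤^-self 3)))
        (+-≤^ b₃≤
              (+-≤^ (*-≤^ (+-≤^ (*-≤^ (≤⇒≤^1 n≤N) (spread≤^ d)) (≤^-self 0)) iteration≤) (≤^-self 3))))
      (≤^-self 9)))
    (≤-reflexive (cong (N ^_) (exponent i p e d)))
    where
    iteration≤ = +-≤^ (≤^-self 3) b₂≤
    exponent : ∀ i p e d →
      1 + ((1 + ((1 + ((1 + (2 + (1 + (2 + i)))) + (1 + ((2 + (1 + (3 + p))) + 3))))
               + (1 + (e + (1 + (((1 + ((1 + (1 + d)) + 0)) + (1 + (3 + p))) + 3)))))) + 9)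
        ≡ d + (40 + (i + e + (p + p)))
    exponent = solve-∀

-- Execution of the two loops

module Machine {n} (G : Graph (Fin n)) (connected : Connected G)
  {init : Term 0} {proc exp : Term 3} (implementation : Correctness.Implementation G init proc exp)
  where

  open Algorithm G
  open Correctness G hiding (implementation)
  open Implementation implementation
  open Graphs G
  open Search G connected
  open Enumerator init proc exp

  state : State → Store 3
  state st = store (tabulate row) (environment st) nil

  iteration : ℕ
  iteration = 3 + bound n (step proc)

  -- The potential `φ` is at once the fuel of the induction and the bound on the number of
  -- iterations.
  work-run : ∀ {Ps} φ {W Xs t} → Invariant Ps Xs t → Pending W φ → ∃₂ λ X′ t′ →
             Advance Ps W t [] X′ t′ ×
             Run work (state (W , Xs , t)) (φ * iteration + 3) (state ([] , X′ , t′))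
  work-run φ {Xs = Xs} {t} inv [] =
    Xs , t , record { invariant = inv ; mono = λ v → v ; hits = λ _ h → h } ,
    run-weaken (m≤n+m 3 (φ * iteration)) (run-stop refl)
  work-run zero inv (push {k = k} vc rank le p) =
    contradiction (≤-trans (1≤spread n k) (≤-trans (m≤m+n _ _) le)) λ ()
  work-run {Ps} (suc φ) {S ∷ W} {Xs} {t} inv (push vc rank le p)
    with process S (W , Xs , t) | proc-⇓ S W Xs t | process-step inv vc rank p
  ... | _ | derivation | record { W′ = W′ ; X′ = X′ ; t′ = t′ ; result = refl
                           ; advance = a ; fewer = f ; pending = p′ }
    with work-run φ {W′} {X′} {t′} (Advance.invariant a)
           (pending-weaken (ℕ.≤-pred (≤-trans f le)) p′)
  ...   | X″ , t″ , a′ , r = X″ , t″ , advance-trans a a′ ,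
    run-weaken (≤-reflexive (cong (3 +_) (sym (+-assoc (bound n (step proc)) (φ * iteration) 3))))
      (run-loop refl (step-run (tabulate row) derivation) r)

  Enumerated : List (Subset n) → Set
  Enumerated Cs = Unique Cs × (∀ C → C ∈ₗ Cs ⇔ MinimalConnectedVertexCover G C)

  module MainLoop {d} (clawFree : ClawFree d G) (P D : ℕ) (P+9≤D : P + 9 ≤ D)
    (phase≤P : bound n (step exp) + ((n * spread n d + 0) * iteration + 3) ≤ P) where

    record Finished (Ps : List (Subset n)) (σ : Store 3) : Set where
      field
        {trace}    : Trace
        {final}    : Store 3
        execution  : Exec main σ trace final
        -- `k` is the time that has already passed since the last output when the loop test is
        -- reached.
        delay      : ∀ k → k ≤ P → All (_≤ D) (gapsFrom k trace)
        printed    : List (Subset n)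
        faithful   : outputs trace ≡ map encodeSubset printed
        enumerated : Enumerated (Ps ++ printed)

    -- Of the 9 units, 4 go to the test of `hd (tl env)`, 4 to the evaluation of the output
    -- expression and 1 to the output itself; the final failing test takes only the first 4.
    late : ∀ {k j} → k ≤ P → j ≤ 9 → j + k ≤ D
    late {k} {j} k≤P j≤9 = ≤-trans (≤-reflexive (+-comm j k)) (≤-trans (+-mono-≤ k≤P j≤9) P+9≤D)

    -- The unprocessed covers of the at most 2 ^ n subsets serve as fuel.
    main-run : ∀ fuel {Ps Xs t} → Invariant Ps Xs t → Closed Ps t → ∃ (Visited t) →
               2 ^ n ≤ length Ps + fuel → Finished Ps (state ([] , Xs , t))
    main-run fuel {Ps} {[]} {t} inv closed nonempty enough = record
      { execution  = stop refl
      ; delay      = λ k k≤P → late k≤P (s≤s (s≤s (s≤s (s≤s z≤n)))) ∷ []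
      ; printed    = []
      ; faithful   = refl
      ; enumerated = subst Enumerated (sym (++-identityʳ Ps))
          (uniquePs , λ C → mk⇔ (λ C∈ → minimal (complete (inj₂ C∈))) (closed-complete inv closed nonempty)) }
      where open Invariant inv
    main-run zero {Ps} {X ∷ Xs} inv closed nonempty enough = contradiction
      (≤-trans (≤-reflexive (trans (+-comm 1 (length Ps)) (sym (length-++ Ps))))
        (≤-trans (unique-length (Invariant.uniquePs (pop-invariant inv)))
          (≤-trans enough (≤-reflexive (ℕ.+-identityʳ _)))))
      (ℕ.<-irrefl refl)
    main-run (suc fuel) {Ps} {X ∷ Xs} {t} inv closed (Y , visitedY) enough
      with work-run (n * spread n d + 0) (pop-invariant inv)
             (Exchange.exchanges-pending clawFree (Invariant.minimal inv (Invariant.complete inv (inj₁ (here refl)))))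
    ... | X′ , t′ , advance , run
      with step-run (tabulate row) (exp-⇓ X Xs t) ⨾ run
         | main-run fuel (Advance.invariant advance)
             (Exchange.exchange-closed clawFree
               (Invariant.minimal inv (Invariant.complete inv (inj₁ (here refl)))) closed advance)
             (Y , Advance.mono advance visitedY)
             (≤-trans enough (≤-reflexive (trans (ℕ.+-suc (length Ps) fuel)
               (cong (_+ fuel) (trans (+-comm 1 (length Ps)) (sym (length-++ Ps)))))))
    ...   | j , j≤ , expansion | record { trace = τ ; execution = rest ; delay = delay
                                        ; printed = Cs ; faithful = faithful ; enumerated = enumerated } = record
      { execution  = loop refl (seq emit expansion) rest
      ; delay      = λ k k≤P → late k≤P ≤-refl ∷
          subst (All (_≤ D)) (sym (trans (gaps-ticks 0 j τ) (cong (λ i → gapsFrom i τ) (ℕ.+-identityʳ j))))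
            (delay j (≤-trans j≤ phase≤P))
      ; printed    = X ∷ Cs
      ; faithful   = cong (encodeSubset X ∷_) (trans (outputs-ticks j τ) faithful)
      ; enumerated = subst Enumerated (++-assoc Ps (X ∷ []) Cs) enumerated }

  initial-invariant : Invariant [] [] nil
  initial-invariant = record
    { uniquePs = [] ; uniqueXs = [] ; disjoint = λ () ; complete = λ { (inj₁ ()) ; (inj₂ ()) }
    ; sound = λ v → contradiction v unvisited ; minimal = λ v → contradiction v unvisited }
    where
    unvisited : ∀ {Y : Subset n} → ¬ Visited nil Y
    unvisited {Y} (visited v) rewrite search-nil Y = v

  -- Saving the rows and clearing the environment cost 2 units each.
  setup : ℕ
  setup = 2 + (2 + bound n (step init))

  enumerates : ∀ {d} → ClawFree d G → ∀ P D → P + 9 ≤ D →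
    setup + (spread n 1 * iteration + 3) ≤ P →
    bound n (step exp) + ((n * spread n d + 0) * iteration + 3) ≤ P →
    Enumerates (program body) G (MinimalConnectedVertexCover G) D
  enumerates {d} clawFree P D P+9≤D start≤P phase≤P
    with work-run {[]} (spread n 1) {⊤ ∷ []} initial-invariant
           (push (proj₁ (⊤-cvc connected)) (⊤-rank connected) (≤-reflexive (ℕ.+-identityʳ _)) ([] {φ = 0}))
  ... | X′ , t′ , advance , run
    with start (encodeGraph-rows G)
       | MainLoop.main-run clawFree P D P+9≤D phase≤P (2 ^ n) (Advance.invariant advance) (λ ()) nonempty ≤-refl
    where
    start : ∀ {input} → input ≡ ⟨ tabulate row ⟩ →
            Run (2F := env ⨟ 0F := nil ⨟ step init ⨟ work) (input ∷ nil ∷ nil ∷ [])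
                (2 + (2 + (bound n (step init) + (spread n 1 * iteration + 3)))) (state ([] , X′ , t′))
    start refl = run-assign ⨾ run-assign ⨾ step-run (tabulate row) init-⇓ ⨾ run
    nonempty : ∃ (Visited t′)
    -- With the full vertex set as region, the initial phase must have found some cover.
    nonempty with Advance.hits advance (⊤-cvc connected) (inj₂ (⊤ , here refl , id))
    ... | inj₁ (Y , v , _) = Y , v
  ...   | j , j≤ , prefix | record { trace = τ ; execution = rest ; delay = delay
                                   ; printed = Cs ; faithful = faithful ; enumerated = unique , members } =
    ticks j ++ τ , (_ , seq prefix rest) ,
    subst (All (_≤ D)) (sym (trans (gaps-ticks 0 j τ) (cong (λ i → gapsFrom i τ) (ℕ.+-identityʳ j))))
      (delay j (≤-trans j≤ start≤P)) ,
    Cs , trans (outputs-ticks j τ) faithful , unique , members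

  enumerates-within : ∀ {d} → ClawFree d G →
    Enumerates (program body) G (MinimalConnectedVertexCover G)
      ((n ⊔ 2) ^ (d + delayExponent (degree (step init)) (degree (step proc)) (degree (step exp))))
  -- The sum of the two phases bounds each of them, which avoids a maximum in the power estimate.
  enumerates-within {d} clawFree = enumerates clawFree (before + after) _
    (delay≤ d (bound≤^degree (step init) n≤N) (bound≤^degree (step proc) n≤N) (bound≤^degree (step exp) n≤N))
    (m≤m+n before after) (m≤n+m after before)
    where
    open Delay n
    open Powers 2≤N
    before = setup + (spread n 1 * iteration + 3)
    after  = bound n (step exp) + ((n * spread n d + 0) * iteration + 3)

theorem3 : ∃[ P ] ∃[ c ] ∀ (d n : ℕ) (G : Graph (Fin n)) →
    Connected G → ClawFree d G →
    Enumerates P G (MinimalConnectedVertexCover G) ((n ⊔ 2) ^ (d + c))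
theorem3 =
  program (Enumerator.body initialᵗ processᵗ expandᵗ) ,
  delayExponent (degree (step initialᵗ)) (degree (step processᵗ)) (degree (step expandᵗ)) ,
  λ d n G connected clawFree →
    Machine.enumerates-within G connected (Correctness.implementation G) clawFree
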